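{- Let $A_2(n)$ denote the number of simply paired partitions of $n$ having pairing rank $-2$. For a nonnegative integer $m$, let $\chi(m)=1$ if $m=2^\alpha u^2$ for some $\alpha\ge0$ and some positive odd integer $u$, and $\chi(m)=0$ otherwise. Then for every $n\geq 0$, $$A_2(n+8)+A_2(n)\equiv n+1+\chi(n+3)+\chi(n+7)\pmod 2.$$ In particular, if $n$ is even, then $A_2(n+8)$ and $A_2(n)$ have the same parity if and only if one of $n+3$ and $n+7$ is a perfect square.
   Context: A partition is simply paired if no part occurs more than three times. For a partition $\lambda$, let $r(\lambda)$ be the largest part size of multiplicity at least $2$ ($r(\lambda)=0$ if $\lambda$ has distinct parts). Let $u_1>u_2>\cdots$ be the part sizes occurring with odd multiplicity, each taken once, and let $s(\lambda)=u_1-u_2+u_3-u_4+\cdots$ ($0$ if there are none). The pairing rank is $\rho(\lambda)=r(\lambda)-s(\lambda)$. -}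

module Defs where

open import Data.Bool using (if_then_else_)
open import Data.Integer as ℤ using (ℤ; +_)
import Data.Integer.Properties as ℤ
open import Data.List using (List; []; _∷_; _++_; map; filter; length; foldr; deduplicate)
open import Data.List.Extrema.Nat using (max)
open import Data.List.Membership.Propositional using (_∈_)
open import Data.List.Membership.Propositional.Properties
  using (∈-map⁺; ∈-map⁻; ∈-++⁺ˡ; ∈-++⁺ʳ; ∈-++⁻; ∈-filter⁺; ∈-filter⁻)
open import Data.List.Properties using (∷-injectiveʳ)
open import Data.List.Relation.Unary.All as All using (All; []; _∷_; all?)
open import Data.List.Relation.Unary.AllPairs using (AllPairs; []; _∷_)
open import Data.List.Relation.Unary.Any using (here)
open import Data.List.Relation.Unary.Unique.Propositional using (Unique)
import Data.List.Relation.Unary.Unique.Propositional.Properties as Unique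
open import Data.Nat
open import Data.Nat.ListAction using (sum)
open import Data.Nat.Properties
open import Data.Product using (∃-syntax; _×_; _,_)
open import Data.Sum using (inj₁; inj₂)
open import Relation.Binary.PropositionalEquality
open import Relation.Nullary using (Dec; yes; no; ¬_; contradiction)
open import Relation.Nullary.Decidable using (does; map′; _×-dec_)

record IsPartition (n : ℕ) (p : List ℕ) : Set where
  constructor isPartition
  field
    decreasing : AllPairs _≥_ p
    positive   : All (0 <_) p
    size       : sum p ≡ n

-- All weakly decreasing lists of at most l positive parts, each at most k.
box : (l k : ℕ) → List (List ℕ)
box zero    k       = [] ∷ []
box (suc l) zero    = [] ∷ []
box (suc l) (suc k) = map (suc k ∷_) (box l (suc k)) ++ box (suc l) k

-- A partition of n has at most n parts, each at most n; see
-- ∈-partitions⁺, ∈-partitions⁻ and partitions-unique below.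
partitions : ℕ → List (List ℕ)
partitions n = filter (λ p → sum p ≟ n) (box n n)

multiplicity : ℕ → List ℕ → ℕ
multiplicity x p = length (filter (x ≟_) p)

SimplyPaired : List ℕ → Set
SimplyPaired p = All (λ x → multiplicity x p ≤ 3) p

simplyPaired? : ∀ p → Dec (SimplyPaired p)
simplyPaired? p = all? (λ x → multiplicity x p ≤? 3) p

r : List ℕ → ℕ
r p = max 0 (filter (λ x → 2 ≤? multiplicity x p) p)

-- u₁ > u₂ > ⋯ ; both filter and deduplicate keep the order of p.
oddSizes : List ℕ → List ℕ
oddSizes p = filter (λ x → multiplicity x p % 2 ≟ 1) (deduplicate _≟_ p)

-- a₁ - (a₂ - (a₃ - ⋯)) = a₁ - a₂ + a₃ - ⋯
alternatingSum : List ℕ → ℤ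
alternatingSum = foldr (λ a t → + a ℤ.- t) (+ 0)

s : List ℕ → ℤ
s p = alternatingSum (oddSizes p)

pairingRank : List ℕ → ℤ
pairingRank p = + r p ℤ.- s p

A₂ : ℕ → ℕ
A₂ n = length (filter (λ p → simplyPaired? p ×-dec (pairingRank p ℤ.≟ ℤ.- (+ 2))) (partitions n))

PowTwoTimesOddSquare : ℕ → Set
PowTwoTimesOddSquare m = ∃[ α ] ∃[ u ] (u % 2 ≡ 1 × m ≡ 2 ^ α * u ^ 2)

private
  n<2^n : ∀ n → n < 2 ^ n
  n<2^n zero    = s≤s z≤n
  n<2^n (suc n) = begin-strict
    suc n             ≡⟨ +-comm 1 n ⟩
    n + 1             <⟨ +-mono-<-≤ (n<2^n n) (m^n>0 2 n) ⟩
    2 ^ n + 2 ^ n     ≡⟨ cong (λ t → 2 ^ n + t) (+-identityʳ (2 ^ n)) ⟨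
    2 ^ suc n         ∎
    where open ≤-Reasoning

  bounds : ∀ {m α u} → u % 2 ≡ 1 → m ≡ 2 ^ α * u ^ 2 → α < suc m × u < suc m
  bounds {u = zero} ()
  bounds {α = α} {u = suc u} _ refl = s≤s α≤m , s≤s u≤m
    where
    open ≤-Reasoning
    instance
      2^α≢0 : NonZero (2 ^ α)
      2^α≢0 = m^n≢0 2 α
      u²≢0 : NonZero (suc u ^ 2)
      u²≢0 = m^n≢0 (suc u) 2
    α≤m : α ≤ 2 ^ α * suc u ^ 2
    α≤m = begin
      α                  ≤⟨ <⇒≤ (n<2^n α) ⟩
      2 ^ α              ≤⟨ m≤m*n (2 ^ α) (suc u ^ 2) ⟩
      2 ^ α * suc u ^ 2  ∎
    u≤m : suc u ≤ 2 ^ α * suc u ^ 2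
    u≤m = begin
      suc u              ≡⟨ ^-identityʳ (suc u) ⟨
      suc u ^ 1          ≤⟨ ^-monoʳ-≤ (suc u) {1} {2} (s≤s z≤n) ⟩
      suc u ^ 2          ≤⟨ m≤n*m (suc u ^ 2) (2 ^ α) ⟩
      2 ^ α * suc u ^ 2  ∎

powTwoTimesOddSquare? : ∀ m → Dec (PowTwoTimesOddSquare m)
powTwoTimesOddSquare? m = map′
  (λ { (α , _ , u , _ , odd , eq) → α , u , odd , eq })
  (λ { (α , u , odd , eq) → let α< , u< = bounds {α = α} {u} odd eq in α , α< , u , u< , odd , eq })
  (anyUpTo? (λ α → anyUpTo? (λ u → (u % 2 ≟ 1) ×-dec (m ≟ 2 ^ α * u ^ 2)) (suc m)) (suc m))

χ : ℕ → ℕ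
χ m = if does (powTwoTimesOddSquare? m) then 1 else 0

PerfectSquare : ℕ → Set
PerfectSquare m = ∃[ k ] m ≡ k ^ 2

-- partitions n lists every partition of n exactly once

private
  InBox : ℕ → ℕ → List ℕ → Set
  InBox l k p = AllPairs _≥_ p × All (0 <_) p × All (_≤ k) p × length p ≤ l

  box⁺ : ∀ l k {p} → InBox l k p → p ∈ box l k
  box⁺ zero    k       {[]}    _ = here refl
  box⁺ (suc l) zero    {[]}    _ = here refl
  box⁺ (suc l) zero    {x ∷ p} (_ , 0<x ∷ _ , x≤0 ∷ _ , _) = contradiction 0<x (≤⇒≯ x≤0)
  box⁺ (suc l) (suc k) {[]}    _ = ∈-++⁺ʳ (map (suc k ∷_) (box l (suc k))) (box⁺ (suc l) k ([] , [] , [] , z≤n))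
  box⁺ (suc l) (suc k) {x ∷ p} (x≥p ∷ dec , 0<x ∷ pos , x≤k ∷ p≤k , s≤s len) with x ≟ suc k
  ... | yes refl = ∈-++⁺ˡ (∈-map⁺ (suc k ∷_) (box⁺ l (suc k) (dec , pos , p≤k , len)))
  ... | no  x≢k  = ∈-++⁺ʳ (map (suc k ∷_) (box l (suc k)))
    (box⁺ (suc l) k (x≥p ∷ dec , 0<x ∷ pos , x≤k′ ∷ All.map (λ y≤x → ≤-trans y≤x x≤k′) x≥p , s≤s len))
    where
    x≤k′ : x ≤ k
    x≤k′ = s≤s⁻¹ (≤∧≢⇒< x≤k x≢k)

  box⁻ : ∀ l k {p} → p ∈ box l k → InBox l k p
  box⁻ zero    k       (here refl) = [] , [] , [] , z≤n
  box⁻ (suc l) zero    (here refl) = [] , [] , [] , z≤n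
  box⁻ (suc l) (suc k) p∈ with ∈-++⁻ (map (suc k ∷_) (box l (suc k))) p∈
  ... | inj₂ p∈ʳ = let dec , pos , p≤k , len = box⁻ (suc l) k p∈ʳ in
    dec , pos , All.map m≤n⇒m≤1+n p≤k , len
  ... | inj₁ p∈ˡ with ∈-map⁻ (suc k ∷_) p∈ˡ
  ...   | _ , q∈ , refl = let dec , pos , q≤k , len = box⁻ l (suc k) q∈ in
    q≤k ∷ dec , s≤s z≤n ∷ pos , ≤-refl ∷ q≤k , s≤s len

  box-unique : ∀ l k → Unique (box l k)
  box-unique zero    k       = [] ∷ []
  box-unique (suc l) zero    = [] ∷ []
  box-unique (suc l) (suc k) = Unique.++⁺
    (Unique.map⁺ ∷-injectiveʳ (box-unique l (suc k)))
    (box-unique (suc l) k)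
    disjoint
    where
    disjoint : ∀ {p} → ¬ (p ∈ map (suc k ∷_) (box l (suc k)) × p ∈ box (suc l) k)
    disjoint (p∈ˡ , p∈ʳ) with ∈-map⁻ (suc k ∷_) p∈ˡ
    ... | _ , _ , refl = let _ , _ , p≤k , _ = box⁻ (suc l) k p∈ʳ in 1+n≰n (All.head p≤k)

  length≤sum : ∀ {p} → All (0 <_) p → length p ≤ sum p
  length≤sum []          = z≤n
  length≤sum (0<x ∷ pos) = +-mono-≤ 0<x (length≤sum pos)

  parts≤sum : ∀ p → All (_≤ sum p) p
  parts≤sum []      = []
  parts≤sum (x ∷ p) = m≤m+n x (sum p) ∷ All.map (λ y≤ → ≤-trans y≤ (m≤n+m (sum p) x)) (parts≤sum p)

∈-partitions⁺ : ∀ {n p} → IsPartition n p → p ∈ partitions n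
∈-partitions⁺ {p = p} (isPartition dec pos refl) =
  ∈-filter⁺ (λ q → sum q ≟ sum p) (box⁺ _ _ (dec , pos , parts≤sum p , length≤sum pos)) refl

∈-partitions⁻ : ∀ {n p} → p ∈ partitions n → IsPartition n p
∈-partitions⁻ {n} p∈ =
  let p∈box , size = ∈-filter⁻ (λ q → sum q ≟ n) {xs = box n n} p∈
      dec , pos , _ = box⁻ n n p∈box
  in isPartition dec pos size

partitions-unique : ∀ n → Unique (partitions n)
partitions-unique n = Unique.filter⁺ (λ p → sum p ≟ n) (box-unique n n)

{-# OPTIONS --safe #-}

-- A simply paired partition is a pair (U, D) of sets of positive integers: U holds the
-- sizes of odd multiplicity and D those of multiplicity at least 2, so that r = max D, s is
-- the alternating sum of U, and n = |U| + 2|D|. The sets U with alternating sum s have the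
-- generating function q^s / (q²;q²)ₛ, because those with parts at most k are counted by
-- q^s times the Gaussian binomial [k choose s] at q². Modulo 2 the product (-q²;q²) coming
-- from D cancels most of this denominator, leaving
--   Σ A₂(n) qⁿ ≡ q² / ((1 - q²)(1 - q⁴)) + Σ_{r ≥ 1} q^(3r+2) / ((1 - q^2r)(1 - q^(2r+2))(1 - q^(2r+4))).
-- By partial fractions in q^2r, multiplication by 1 + q⁸ ≡ (1 + q²)(1 + q²)(1 + q⁴) turns the
-- sum into (q + q⁵) Σ q^3r / (1 - q^2r) up to explicit terms. The n-th coefficient of this
-- Lambert series is one less than the number of odd divisors of n, whose parity is χ(n).
module Submission where

open import Defs
open import Data.Bool using (Bool; true; false; if_then_else_)
open import Data.Empty using (⊥)
open import Data.Integer as ℤ using (+_)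
import Data.Integer.Properties as ℤ
open import Data.List using (List; []; _∷_; _++_; map; filter; length; replicate; deduplicate)
open import Data.List.Extrema.Nat using (max; max≈v⁺)
open import Data.List.Membership.Propositional.Properties using (∈-filter⁺)
open import Data.List.Properties using (filter-++; filter-all; filter-none; filter-accept; filter-reject)
open import Data.List.Relation.Unary.All as All using (All; []; _∷_; all?)
import Data.List.Relation.Unary.All.Properties as All
open import Data.List.Relation.Unary.Any using (here)
open import Data.Nat
open import Data.Nat.Divisibility using (_∣_; _∣?_; ∣⇒≤; _∣0; ∣m+n∣m⇒∣n; ∣m∣n⇒∣m+n; ∣-refl; divides)
open import Data.Nat.DivMod using (_%_)
open import Data.Nat.Induction using (<-rec)
open import Data.Nat.ListAction using (sum)
open import Data.Nat.Properties
open import Data.Nat.Solver using (module +-*-Solver)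
open import Data.Parity.Base using (Parity; 0ℙ; 1ℙ; _⁻¹) renaming (_+_ to infixl 6 _⊕_; _*_ to _⊗_)
import Data.Parity.Properties as ℙ
open import Data.Product using (∃; _×_; _,_; proj₁; proj₂)
open import Data.Sum using (_⊎_; inj₁; inj₂)
open import Data.Unit using (tt)
open import Data.Vec using (Vec; []; _∷_)
open import Function using (_∘_)
open import Function.Bundles using (_⇔_; mk⇔; Equivalence)
open import Relation.Binary.Definitions using (tri<; tri≈; tri>)
open import Relation.Binary.PropositionalEquality
open import Relation.Nullary using (Dec; yes; no; ¬_; contradiction; ¬?)
open import Relation.Nullary.Decidable using (does; _×-dec_)
open import Relation.Unary using (Decidable)
import Algebra.Solver.Ring.AlmostCommutativeRing as ACR
import Algebra.Solver.Ring.Simple as RingSolver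

-- Series are plain functions into the parities, with neither quotients nor infinite sums. A
-- denominator 1 - q^a is therefore kept on the other side as the operator `T a`, and `T-injective`
-- cancels it at the end; infinite sums are cut at a bound depending on the coefficient, which
-- stability lemmas show to be harmless. Rank -2 means s = r + 2. The elements of D below its
-- maximum r clear r - 1 of the r + 2 factors in the denominator coming from U, so exactly three
-- remain. Their exponents 2r, 2r + 2, 2r + 4 differ by 2 or 4, which is why (1 + q²)(1 + q⁴) splits
-- every summand at once. That alone leaves q + q³ in front of the Lambert series; the second factor
-- 1 + q² makes this q + q⁵ and, since squaring is additive modulo 2, makes the multiplier 1 + q⁸.

module ℙ-Solver = RingSolver (ACR.fromCommutativeRing ℙ.+-*-commutativeRing) ℙ._≟_

interchange : ∀ p q x y → (p ⊕ q) ⊕ (x ⊕ y) ≡ (p ⊕ x) ⊕ (q ⊕ y)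
interchange = solve 4 (λ p q x y → (p :+ q) :+ (x :+ y) := (p :+ x) :+ (q :+ y)) refl
  where open ℙ-Solver

-- Indicators and finite sums modulo 2

⟦_⟧ : ∀ {P : Set} → Dec P → Parity
⟦ yes _ ⟧ = 1ℙ
⟦ no _ ⟧  = 0ℙ

⟦⟧-yes : ∀ {P : Set} (P? : Dec P) → P → ⟦ P? ⟧ ≡ 1ℙ
⟦⟧-yes (yes _) _ = refl
⟦⟧-yes (no ¬p) p = contradiction p ¬p

⟦⟧-no : ∀ {P : Set} (P? : Dec P) → ¬ P → ⟦ P? ⟧ ≡ 0ℙ
⟦⟧-no (yes p) ¬p = contradiction p ¬p
⟦⟧-no (no _)  _  = refl

⟦⟧-cong : ∀ {P Q : Set} (P? : Dec P) (Q? : Dec Q) → (P → Q) → (Q → P) → ⟦ P? ⟧ ≡ ⟦ Q? ⟧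
⟦⟧-cong (yes p) Q? f g = sym (⟦⟧-yes Q? (f p))
⟦⟧-cong (no ¬p) Q? f g = sym (⟦⟧-no Q? (¬p ∘ g))

Σ< : ℕ → (ℕ → Parity) → Parity
Σ< zero    f = 0ℙ
Σ< (suc n) f = Σ< n f ⊕ f n

Σ<-cong : ∀ n {f g} → (∀ i → i < n → f i ≡ g i) → Σ< n f ≡ Σ< n g
Σ<-cong zero    h = refl
Σ<-cong (suc n) h = cong₂ _⊕_ (Σ<-cong n λ i i<n → h i (m<n⇒m<1+n i<n)) (h n ≤-refl)

Σ<-zero : ∀ n {f} → (∀ i → i < n → f i ≡ 0ℙ) → Σ< n f ≡ 0ℙ
Σ<-zero zero    h = refl
Σ<-zero (suc n) h = cong₂ _⊕_ (Σ<-zero n λ i i<n → h i (m<n⇒m<1+n i<n)) (h n ≤-refl)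

Σ<-⊕ : ∀ n f g → Σ< n (λ i → f i ⊕ g i) ≡ Σ< n f ⊕ Σ< n g
Σ<-⊕ zero    f g = refl
Σ<-⊕ (suc n) f g = trans (cong (_⊕ (f n ⊕ g n)) (Σ<-⊕ n f g)) (interchange (Σ< n f) (Σ< n g) (f n) (g n))

Σ<-suc : ∀ n f → Σ< (suc n) f ≡ f 0 ⊕ Σ< n (f ∘ suc)
Σ<-suc zero    f = sym (ℙ.+-identityʳ (f 0))
Σ<-suc (suc n) f = trans (cong (_⊕ f (suc n)) (Σ<-suc n f)) (ℙ.+-assoc (f 0) (Σ< n (f ∘ suc)) (f (suc n)))

Σ<-extend : ∀ {m n f} → m ≤ n → (∀ i → m ≤ i → f i ≡ 0ℙ) → Σ< n f ≡ Σ< m f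
Σ<-extend {m} {n} m≤n h with m≤n⇒m<n∨m≡n m≤n
... | inj₂ refl       = refl
... | inj₁ (s≤s m≤n′) = trans (cong₂ _⊕_ (Σ<-extend m≤n′ h) (h _ m≤n′)) (ℙ.+-identityʳ _)

-- Uniqueness leaves at most one nonzero term, so the sum becomes a truth value.
Σ<-indicator : ∀ {P : ℕ → Set} {Q : Set} (P? : Decidable P) (Q? : Dec Q) n →
               (∀ {i j} → P i → P j → i ≡ j) → (∀ {i} → P i → Q) → (Q → ∃ λ i → i < n × P i) →
               Σ< n (⟦_⟧ ∘ P?) ≡ ⟦ Q? ⟧
Σ<-indicator P? Q? n unique to from with Q?
... | no ¬q = Σ<-zero n λ i _ → ⟦⟧-no (P? i) (¬q ∘ to)
... | yes q with from q
...   | i , i<n , pi = begin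
  Σ< n (⟦_⟧ ∘ P?)          ≡⟨ Σ<-extend i<n (λ j i<j → off λ { refl → <-irrefl refl i<j }) ⟩
  Σ< i (⟦_⟧ ∘ P?) ⊕ ⟦ P? i ⟧ ≡⟨ cong₂ _⊕_ (Σ<-zero i λ j j<i → off λ { refl → <-irrefl refl j<i }) (⟦⟧-yes (P? i) pi) ⟩
  1ℙ                       ∎
  where
  open ≡-Reasoning
  off : ∀ {j} → i ≢ j → ⟦ P? j ⟧ ≡ 0ℙ
  off {j} i≢j = ⟦⟧-no (P? j) λ pj → i≢j (unique pi pj)

-- The off-diagonal terms f i j and f j i cancel.
Σ<-symmetric : ∀ n {f : ℕ → ℕ → Parity} → (∀ i j → f i j ≡ f j i) →
               Σ< n (λ i → Σ< n (f i)) ≡ Σ< n (λ i → f i i)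
Σ<-symmetric zero    sym-f = refl
Σ<-symmetric (suc n) {f} sym-f = begin
  Σ< n (λ i → Σ< n (f i) ⊕ f i n) ⊕ (Σ< n (f n) ⊕ f n n)
    ≡⟨ cong (_⊕ (Σ< n (f n) ⊕ f n n)) (Σ<-⊕ n _ _) ⟩
  Σ< n (λ i → Σ< n (f i)) ⊕ Σ< n (λ i → f i n) ⊕ (Σ< n (f n) ⊕ f n n)
    ≡⟨ cong₂ (λ x y → x ⊕ y ⊕ (Σ< n (f n) ⊕ f n n)) (Σ<-symmetric n sym-f) (Σ<-cong n λ i _ → sym-f i n) ⟩
  Σ< n (λ i → f i i) ⊕ Σ< n (f n) ⊕ (Σ< n (f n) ⊕ f n n)
    ≡⟨ solve 3 (λ x y z → x :+ y :+ (y :+ z) := x :+ z) refl (Σ< n (λ i → f i i)) (Σ< n (f n)) (f n n) ⟩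
  Σ< n (λ i → f i i) ⊕ f n n ∎
  where
  open ≡-Reasoning
  open ℙ-Solver

-- Formal power series over 𝔽₂

Series : Set
Series = ℕ → Parity

one : Series
one zero    = 1ℙ
one (suc _) = 0ℙ

infixl 5 _⊞_
_⊞_ : Series → Series → Series
(f ⊞ g) n = f n ⊕ g n

-- shift a f is q^a f.
shift : ℕ → Series → Series
shift zero    f n       = f n
shift (suc a) f zero    = 0ℙ
shift (suc a) f (suc n) = shift a f n

-- T a f is (1 + q^a) f.
T : ℕ → Series → Series
T a f = f ⊞ shift a f

-- Multiplication by q^a never looks at coefficients beyond `n`. Hence a series may be replaced by a
-- truncation that is correct only up to the coefficient in question.
shift-cong-≤ : ∀ a {f g} n → (∀ {m} → m ≤ n → f m ≡ g m) → shift a f n ≡ shift a g n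
shift-cong-≤ zero    n       h = h ≤-refl
shift-cong-≤ (suc a) zero    h = refl
shift-cong-≤ (suc a) (suc n) h = shift-cong-≤ a n (h ∘ m≤n⇒m≤1+n)

shift-cong : ∀ a {f g} → f ≗ g → shift a f ≗ shift a g
shift-cong a f≗g n = shift-cong-≤ a n λ {m} _ → f≗g m

shift-⊞ : ∀ a f g → shift a (f ⊞ g) ≗ shift a f ⊞ shift a g
shift-⊞ zero    f g n       = refl
shift-⊞ (suc a) f g zero    = refl
shift-⊞ (suc a) f g (suc n) = shift-⊞ a f g n

shift-zero : ∀ a {f} n → (∀ {m} → m ≤ n → f m ≡ 0ℙ) → shift a f n ≡ 0ℙ
shift-zero zero    n       h = h ≤-refl
shift-zero (suc a) zero    h = refl
shift-zero (suc a) (suc n) h = shift-zero a n (h ∘ m≤n⇒m≤1+n)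

shift-+ : ∀ a b f → shift a (shift b f) ≗ shift (a + b) f
shift-+ zero    b f n       = refl
shift-+ (suc a) b f zero    = refl
shift-+ (suc a) b f (suc n) = shift-+ a b f n

shift-at-+ : ∀ a f n → shift a f (a + n) ≡ f n
shift-at-+ zero    f n = refl
shift-at-+ (suc a) f n = shift-at-+ a f n

shift-at-< : ∀ {a n} f → n < a → shift a f n ≡ 0ℙ
shift-at-< {suc a} {zero}  f _       = refl
shift-at-< {suc a} {suc n} f (s≤s p) = shift-at-< f p

shift-shift : ∀ {a b c d} f → a + b ≡ c + d → shift a (shift b f) ≗ shift c (shift d f)
shift-shift {a} {b} {c} {d} f eq n =
  trans (shift-+ a b f n) (trans (cong (λ e → shift e f n) eq) (sym (shift-+ c d f n)))

shift-Σ< : ∀ a k (F : ℕ → Series) n → shift a (λ m → Σ< k (λ i → F i m)) n ≡ Σ< k (λ i → shift a (F i) n)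
shift-Σ< a zero    F n = shift-zero a n λ _ → refl
shift-Σ< a (suc k) F n = trans (shift-⊞ a (λ m → Σ< k (λ i → F i m)) (F k) n) (cong (_⊕ shift a (F k) n) (shift-Σ< a k F n))

T-cong-≤ : ∀ a {f g} n → (∀ {m} → m ≤ n → f m ≡ g m) → T a f n ≡ T a g n
T-cong-≤ a n h = cong₂ _⊕_ (h ≤-refl) (shift-cong-≤ a n h)

T-cong : ∀ a {f g} → f ≗ g → T a f ≗ T a g
T-cong a f≗g n = T-cong-≤ a n λ {m} _ → f≗g m

T-⊞ : ∀ a f g → T a (f ⊞ g) ≗ T a f ⊞ T a g
T-⊞ a f g n = trans (cong (f n ⊕ g n ⊕_) (shift-⊞ a f g n)) (interchange (f n) (g n) _ _)

T-Σ< : ∀ a k (F : ℕ → Series) n → T a (λ m → Σ< k (λ i → F i m)) n ≡ Σ< k (λ i → T a (F i) n)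
T-Σ< a k F n = trans (cong (Σ< k (λ i → F i n) ⊕_) (shift-Σ< a k F n)) (sym (Σ<-⊕ k _ _))

T-shift : ∀ a b f → T a (shift b f) ≗ shift b (T a f)
T-shift a b f n = trans (cong (shift b f n ⊕_) (shift-shift {a} {b} {b} {a} f (+-comm a b) n)) (sym (shift-⊞ b f (shift a f) n))

T-comm : ∀ a b f → T a (T b f) ≗ T b (T a f)
T-comm a b f n = begin
  f n ⊕ shift b f n ⊕ shift a (T b f) n                    ≡⟨ cong (f n ⊕ shift b f n ⊕_) (shift-⊞ a f (shift b f) n) ⟩
  f n ⊕ shift b f n ⊕ (shift a f n ⊕ shift a (shift b f) n) ≡⟨ interchange (f n) _ _ _ ⟩
  f n ⊕ shift a f n ⊕ (shift b f n ⊕ shift a (shift b f) n)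
    ≡⟨ cong (λ x → f n ⊕ shift a f n ⊕ (shift b f n ⊕ x)) (shift-shift {a} {b} {b} {a} f (+-comm a b) n) ⟩
  f n ⊕ shift a f n ⊕ (shift b f n ⊕ shift b (shift a f) n) ≡⟨ cong (f n ⊕ shift a f n ⊕_) (shift-⊞ b f (shift a f) n) ⟨
  f n ⊕ shift a f n ⊕ shift b (T a f) n                    ∎
  where open ≡-Reasoning

-- The cross terms of (1 + q^a)² cancel in characteristic 2.
T-square : ∀ a f → T a (T a f) ≗ T (a + a) f
T-square a f n = begin
  f n ⊕ shift a f n ⊕ shift a (T a f) n                    ≡⟨ cong (f n ⊕ shift a f n ⊕_) (shift-⊞ a f (shift a f) n) ⟩
  f n ⊕ shift a f n ⊕ (shift a f n ⊕ shift a (shift a f) n)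
    ≡⟨ solve 3 (λ x y z → x :+ y :+ (y :+ z) := x :+ z) refl (f n) (shift a f n) _ ⟩
  f n ⊕ shift a (shift a f) n                              ≡⟨ cong (f n ⊕_) (shift-+ a a f n) ⟩
  f n ⊕ shift (a + a) f n                                  ∎
  where
  open ≡-Reasoning
  open ℙ-Solver

-- For a > 0 the shifted copy only involves lower coefficients, so they can be cancelled by strong
-- induction. This takes the place of dividing by 1 + q^a.
T-injective : ∀ a .{{_ : NonZero a}} {f g} → T a f ≗ T a g → f ≗ g
T-injective (suc a) {f} {g} eq = <-rec _ step
  where
  open ≡-Reasoning
  shift-cong-< : ∀ n → (∀ {m} → m < n → f m ≡ g m) → shift (suc a) f n ≡ shift (suc a) g n
  shift-cong-< zero    ih = refl
  shift-cong-< (suc n) ih = shift-cong-≤ a n (ih ∘ s≤s)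
  step : ∀ n → (∀ {m} → m < n → f m ≡ g m) → f n ≡ g n
  step n ih = ℙ.+-cancelʳ-≡ (shift (suc a) g n) (f n) (g n)
    (trans (cong (f n ⊕_) (sym (shift-cong-< n ih))) (eq n))

-- The source of all partial fraction decompositions below.
T-split : ∀ a b f → T b f ≗ T (a + b) f ⊞ shift b (T a f)
T-split a b f n = sym (begin
  f n ⊕ shift (a + b) f n ⊕ shift b (T a f) n
    ≡⟨ cong₂ (λ x y → f n ⊕ x ⊕ y) (sym (trans (shift-+ b a f n) (cong (λ e → shift e f n) (+-comm b a)))) (shift-⊞ b f (shift a f) n) ⟩
  f n ⊕ shift b (shift a f) n ⊕ (shift b f n ⊕ shift b (shift a f) n)
    ≡⟨ solve 3 (λ x y z → x :+ y :+ (z :+ y) := x :+ z) refl (f n) _ _ ⟩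
  f n ⊕ shift b f n ∎)
  where
  open ≡-Reasoning
  open ℙ-Solver

-- Sets of distinct parts

-- A vector of length k is a subset of {1, …, k}; its head decides membership of k.

Σᵇ : ∀ k → (Vec Bool k → Parity) → Parity
Σᵇ zero    f = f []
Σᵇ (suc k) f = Σᵇ k (f ∘ (false ∷_)) ⊕ Σᵇ k (f ∘ (true ∷_))

Σᵇ-cong : ∀ k {f g} → f ≗ g → Σᵇ k f ≡ Σᵇ k g
Σᵇ-cong zero    f≗g = f≗g []
Σᵇ-cong (suc k) f≗g = cong₂ _⊕_ (Σᵇ-cong k (f≗g ∘ (false ∷_))) (Σᵇ-cong k (f≗g ∘ (true ∷_)))

Σᵇ-zero : ∀ k {f} → (∀ v → f v ≡ 0ℙ) → Σᵇ k f ≡ 0ℙ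
Σᵇ-zero zero    f≗0 = f≗0 []
Σᵇ-zero (suc k) f≗0 = cong₂ _⊕_ (Σᵇ-zero k (f≗0 ∘ (false ∷_))) (Σᵇ-zero k (f≗0 ∘ (true ∷_)))

Σᵇ-⊕ : ∀ k f g → Σᵇ k (λ v → f v ⊕ g v) ≡ Σᵇ k f ⊕ Σᵇ k g
Σᵇ-⊕ zero    f g = refl
Σᵇ-⊕ (suc k) f g = trans (cong₂ _⊕_ (Σᵇ-⊕ k _ _) (Σᵇ-⊕ k _ _))
  (interchange (Σᵇ k (f ∘ (false ∷_))) (Σᵇ k (g ∘ (false ∷_))) _ _)

Σᵇ-swap : ∀ k l (f : Vec Bool k → Vec Bool l → Parity) →
          Σᵇ k (λ v → Σᵇ l (f v)) ≡ Σᵇ l (λ w → Σᵇ k (λ v → f v w))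
Σᵇ-swap zero    l f = refl
Σᵇ-swap (suc k) l f = trans (cong₂ _⊕_ (Σᵇ-swap k l _) (Σᵇ-swap k l _)) (sym (Σᵇ-⊕ l _ _))

shift-Σᵇ : ∀ a k (F : Vec Bool k → Series) n → shift a (λ m → Σᵇ k (λ v → F v m)) n ≡ Σᵇ k (λ v → shift a (F v) n)
shift-Σᵇ a zero    F n = refl
shift-Σᵇ a (suc k) F n = trans (shift-⊞ a _ _ n) (cong₂ _⊕_ (shift-Σᵇ a k (F ∘ (false ∷_)) n) (shift-Σᵇ a k (F ∘ (true ∷_)) n))

size : ∀ {k} → Vec Bool k → ℕ
size {zero}  []          = 0
size {suc k} (false ∷ v) = size v
size {suc k} (true  ∷ v) = suc k + size v

-- The value 0 at the empty set matches r = 0 for distinct parts.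
top : ∀ {k} → Vec Bool k → ℕ
top {zero}  []          = 0
top {suc k} (false ∷ v) = top v
top {suc k} (true  ∷ v) = suc k

alt : ∀ {k} → Vec Bool k → ℕ
alt {zero}  []          = 0
alt {suc k} (false ∷ v) = alt v
alt {suc k} (true  ∷ v) = suc k ∸ alt v

-- Makes the truncated subtraction in `alt` exact, so that it agrees with the integer `s`.
alt≤ : ∀ {k} (v : Vec Bool k) → alt v ≤ k
alt≤ {zero}  []          = z≤n
alt≤ {suc k} (false ∷ v) = m≤n⇒m≤1+n (alt≤ v)
alt≤ {suc k} (true  ∷ v) = m∸n≤m (suc k) (alt v)

monomial-shift : ∀ {P : Set} (P? : Dec P) m x n →
                 shift m (λ n → ⟦ P? ×-dec (x ≟ n) ⟧) n ≡ ⟦ P? ×-dec (m + x ≟ n) ⟧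
monomial-shift P? zero    x n       = refl
monomial-shift P? (suc m) x zero    = sym (⟦⟧-no (P? ×-dec (suc (m + x) ≟ 0)) λ ())
monomial-shift P? (suc m) x (suc n) = trans (monomial-shift P? m x n)
  (⟦⟧-cong (P? ×-dec (m + x ≟ n)) (P? ×-dec (suc (m + x) ≟ suc n))
    (λ (p , eq) → p , cong suc eq) (λ (p , eq) → p , suc-injective eq))

-- Alternating sums and Gaussian binomials

altSeries : ℕ → ℕ → Series
altSeries k s n = Σᵇ k λ U → ⟦ (alt U ≟ s) ×-dec (size U ≟ n) ⟧

altSeries-large : ∀ k {s} → k < s → ∀ n → altSeries k s n ≡ 0ℙ
altSeries-large k {s} k<s n = Σᵇ-zero k λ U →
  ⟦⟧-no ((alt U ≟ s) ×-dec (size U ≟ n)) λ (eq , _) → <⇒≢ (≤-<-trans (alt≤ U) k<s) eq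

-- A new largest part `k + 1` turns an alternating sum t into `k + 1` - t, so the sets containing it
-- come from the reflected value.
altSeries-suc : ∀ k {s} → s ≤ suc k → altSeries (suc k) s ≗ altSeries k s ⊞ shift (suc k) (altSeries k (suc k ∸ s))
altSeries-suc k {s} s≤k n = cong (altSeries k s n ⊕_) (begin
  Σᵇ k (λ U → ⟦ (suc k ∸ alt U ≟ s) ×-dec (suc k + size U ≟ n) ⟧)
    ≡⟨ Σᵇ-cong k (λ U → ⟦⟧-cong ((suc k ∸ alt U ≟ s) ×-dec (suc k + size U ≟ n)) ((alt U ≟ suc k ∸ s) ×-dec (suc k + size U ≟ n))
         (λ (eq , e) → sym (flip∸ (m≤n⇒m≤1+n (alt≤ U)) eq) , e) (λ (eq , e) → flip∸ s≤k (sym eq) , e)) ⟩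
  Σᵇ k (λ U → ⟦ (alt U ≟ suc k ∸ s) ×-dec (suc k + size U ≟ n) ⟧)
    ≡⟨ Σᵇ-cong k (λ U → monomial-shift (alt U ≟ suc k ∸ s) (suc k) (size U) n) ⟨
  Σᵇ k (λ U → shift (suc k) (λ n → ⟦ (alt U ≟ suc k ∸ s) ×-dec (size U ≟ n) ⟧) n)
    ≡⟨ shift-Σᵇ (suc k) k _ n ⟨
  shift (suc k) (altSeries k (suc k ∸ s)) n ∎)
  where
  open ≡-Reasoning
  flip∸ : ∀ {a b c} → a ≤ c → c ∸ a ≡ b → c ∸ b ≡ a
  flip∸ a≤c refl = m∸[m∸n]≡n a≤c

-- gauss a b is the Gaussian binomial coefficient [a + b choose a] at q².
gauss : ℕ → ℕ → Series
gauss zero    b       = one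
gauss (suc a) zero    = one
gauss (suc a) (suc b) = gauss a (suc b) ⊞ shift (2 * suc a) (gauss (suc a) b)

gauss-zeroʳ : ∀ a → gauss a 0 ≗ one
gauss-zeroʳ zero    n = refl
gauss-zeroʳ (suc a) n = refl

-- The other q-Pascal rule. Expanding by either rule and then by the other gives the same four
-- terms; the two routes to `gauss (suc a) (suc b)` with both shifts carry the same total exponent.
gauss-dual : ∀ a b → gauss (suc a) (suc b) ≗ shift (2 * suc b) (gauss a (suc b)) ⊞ gauss (suc a) b
gauss-dual zero    zero    n = ℙ.+-comm (one n) _
gauss-dual zero    (suc b) n = begin
  one n ⊕ shift 2 (gauss 1 (suc b)) n
    ≡⟨ cong (one n ⊕_) (trans (shift-cong 2 (gauss-dual 0 b) n) (shift-⊞ 2 _ _ n)) ⟩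
  one n ⊕ (shift 2 (shift (2 * suc b) one) n ⊕ shift 2 (gauss 1 b) n)
    ≡⟨ solve 3 (λ x y z → x :+ (y :+ z) := y :+ (x :+ z)) refl (one n) (shift 2 (shift (2 * suc b) one) n) (shift 2 (gauss 1 b) n) ⟩
  shift 2 (shift (2 * suc b) one) n ⊕ (one n ⊕ shift 2 (gauss 1 b) n)
    ≡⟨ cong (_⊕ gauss 1 (suc b) n) (shift-+ 2 (2 * suc b) one n) ⟩
  shift (2 + 2 * suc b) one n ⊕ gauss 1 (suc b) n
    ≡⟨ cong (λ e → shift e one n ⊕ gauss 1 (suc b) n) (*-suc 2 (suc b)) ⟨
  shift (2 * suc (suc b)) one n ⊕ gauss 1 (suc b) n ∎
  where
  open ≡-Reasoning
  open ℙ-Solver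
gauss-dual (suc a) zero    n = begin
  gauss (suc a) 1 n ⊕ shift (2 * suc (suc a)) one n
    ≡⟨ cong (_⊕ shift (2 * suc (suc a)) one n) (gauss-dual a zero n) ⟩
  shift 2 (gauss a 1) n ⊕ one n ⊕ shift (2 * suc (suc a)) one n
    ≡⟨ cong (shift 2 (gauss a 1) n ⊕ one n ⊕_) (trans (cong (λ e → shift e one n) (*-suc 2 (suc a))) (sym (shift-+ 2 (2 * suc a) one n))) ⟩
  shift 2 (gauss a 1) n ⊕ one n ⊕ shift 2 (shift (2 * suc a) one) n
    ≡⟨ solve 3 (λ x y z → x :+ y :+ z := (x :+ z) :+ y) refl (shift 2 (gauss a 1) n) (one n) _ ⟩
  shift 2 (gauss a 1) n ⊕ shift 2 (shift (2 * suc a) one) n ⊕ one n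
    ≡⟨ cong (_⊕ one n) (shift-⊞ 2 _ _ n) ⟨
  shift 2 (gauss (suc a) 1) n ⊕ one n ∎
  where
  open ≡-Reasoning
  open ℙ-Solver
gauss-dual (suc a) (suc b) n = begin
  gauss (suc a) (2 + b) n ⊕ shift (2 * (2 + a)) (gauss (2 + a) (suc b)) n
    ≡⟨ cong₂ _⊕_ (gauss-dual a (suc b) n) (trans (shift-cong (2 * (2 + a)) (gauss-dual (suc a) b) n) (shift-⊞ (2 * (2 + a)) _ _ n)) ⟩
  shift (2 * (2 + b)) (gauss a (2 + b)) n ⊕ g ⊕ (shift (2 * (2 + a)) (shift (2 * suc b) (gauss (suc a) (suc b))) n ⊕ h)
    ≡⟨ cong (λ x → shift (2 * (2 + b)) (gauss a (2 + b)) n ⊕ g ⊕ (x ⊕ h))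
         (shift-shift {2 * (2 + a)} {2 * suc b} {2 * (2 + b)} {2 * suc a} (gauss (suc a) (suc b))
           (solveℕ 2 (λ a b → con 2 ℕ* (con 2 ℕ+ a) ℕ+ con 2 ℕ* (con 1 ℕ+ b) ℕ= con 2 ℕ* (con 2 ℕ+ b) ℕ+ con 2 ℕ* (con 1 ℕ+ a)) refl a b) n) ⟩
  shift (2 * (2 + b)) (gauss a (2 + b)) n ⊕ g ⊕ (shift (2 * (2 + b)) (shift (2 * suc a) (gauss (suc a) (suc b))) n ⊕ h)
    ≡⟨ interchange (shift (2 * (2 + b)) (gauss a (2 + b)) n) g _ h ⟩
  shift (2 * (2 + b)) (gauss a (2 + b)) n ⊕ shift (2 * (2 + b)) (shift (2 * suc a) (gauss (suc a) (suc b))) n ⊕ (g ⊕ h)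
    ≡⟨ cong (_⊕ (g ⊕ h)) (shift-⊞ (2 * (2 + b)) _ _ n) ⟨
  shift (2 * (2 + b)) (gauss (suc a) (2 + b)) n ⊕ gauss (2 + a) (suc b) n ∎
  where
  open ≡-Reasoning
  open +-*-Solver using (con) renaming (solve to solveℕ; _:+_ to infixl 6 _ℕ+_; _:*_ to infixl 7 _ℕ*_; _:=_ to infix 4 _ℕ=_)
  g = gauss (suc a) (suc b) n
  h = shift (2 * (2 + a)) (gauss (2 + a) b) n

-- Swapping the indices exchanges the two Pascal rules.
gauss-sym : ∀ a b → gauss a b ≗ gauss b a
gauss-sym zero    b       n = sym (gauss-zeroʳ b n)
gauss-sym (suc a) zero    n = refl
gauss-sym (suc a) (suc b) n = begin
  gauss a (suc b) n ⊕ shift (2 * suc a) (gauss (suc a) b) n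
    ≡⟨ cong₂ _⊕_ (gauss-sym a (suc b) n) (shift-cong (2 * suc a) (gauss-sym (suc a) b) n) ⟩
  gauss (suc b) a n ⊕ shift (2 * suc a) (gauss b (suc a)) n
    ≡⟨ ℙ.+-comm (gauss (suc b) a n) _ ⟩
  shift (2 * suc a) (gauss b (suc a)) n ⊕ gauss (suc b) a n
    ≡⟨ gauss-dual b a n ⟨
  gauss (suc b) (suc a) n ∎
  where open ≡-Reasoning

-- The reflection in `altSeries-suc` is absorbed by the symmetry of the Gaussian binomial, and the
-- recursion then becomes `gauss-dual`. At both ends of the range one summand vanishes because no
-- alternating sum exceeds `k`.
altSeries-gauss : ∀ k a b → a + b ≡ k → altSeries k a ≗ shift a (gauss a b)
altSeries-gauss zero    zero    zero    refl zero    = refl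
altSeries-gauss zero    zero    zero    refl (suc n) = refl
altSeries-gauss (suc k) zero    (suc k) refl n = begin
  altSeries (suc k) 0 n                                    ≡⟨ altSeries-suc k z≤n n ⟩
  altSeries k 0 n ⊕ shift (suc k) (altSeries k (suc k)) n
    ≡⟨ cong₂ _⊕_ (altSeries-gauss k 0 k refl n) (shift-zero (suc k) n λ {m} _ → altSeries-large k ≤-refl m) ⟩
  one n ⊕ 0ℙ                                               ≡⟨ ℙ.+-identityʳ (one n) ⟩
  one n                                                    ∎
  where open ≡-Reasoning
altSeries-gauss (suc k) (suc a) zero eq n with refl ← trans (sym (+-identityʳ a)) (suc-injective eq) = begin
  altSeries (suc k) (suc k) n                              ≡⟨ altSeries-suc k ≤-refl n ⟩
  altSeries k (suc k) n ⊕ shift (suc k) (altSeries k (k ∸ k)) n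
    ≡⟨ cong₂ (λ x y → x ⊕ shift (suc k) (altSeries k y) n) (altSeries-large k ≤-refl n) (n∸n≡0 k) ⟩
  shift (suc k) (altSeries k 0) n                          ≡⟨ shift-cong (suc k) (altSeries-gauss k 0 k refl) n ⟩
  shift (suc k) one n                                      ∎
  where open ≡-Reasoning
altSeries-gauss (suc k) (suc a) (suc b) refl n = begin
  altSeries (suc k) (suc a) n                              ≡⟨ altSeries-suc k (s≤s (m≤m+n a (suc b))) n ⟩
  altSeries k (suc a) n ⊕ shift (suc k) (altSeries k (k ∸ a)) n
    ≡⟨ cong (λ x → altSeries k (suc a) n ⊕ shift (suc k) (altSeries k x) n) (m+n∸m≡n a (suc b)) ⟩
  altSeries k (suc a) n ⊕ shift (suc k) (altSeries k (suc b)) n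
    ≡⟨ cong₂ _⊕_ (altSeries-gauss k (suc a) b (sym (+-suc a b)) n)
                 (shift-cong (suc k) (λ m → trans (altSeries-gauss k (suc b) a (+-comm (suc b) a) m)
                                                  (shift-cong (suc b) (gauss-sym (suc b) a) m)) n) ⟩
  shift (suc a) (gauss (suc a) b) n ⊕ shift (suc k) (shift (suc b) (gauss a (suc b))) n
    ≡⟨ cong (shift (suc a) (gauss (suc a) b) n ⊕_)
         (shift-shift {suc k} {suc b} {suc a} {2 * suc b} (gauss a (suc b))
           (solve 2 (λ a b → (con 1 :+ (a :+ (con 1 :+ b))) :+ (con 1 :+ b) := (con 1 :+ a) :+ con 2 :* (con 1 :+ b)) refl a b) n) ⟩
  shift (suc a) (gauss (suc a) b) n ⊕ shift (suc a) (shift (2 * suc b) (gauss a (suc b))) n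
    ≡⟨ ℙ.+-comm (shift (suc a) (gauss (suc a) b) n) _ ⟩
  shift (suc a) (shift (2 * suc b) (gauss a (suc b))) n ⊕ shift (suc a) (gauss (suc a) b) n
    ≡⟨ shift-⊞ (suc a) _ _ n ⟨
  shift (suc a) (shift (2 * suc b) (gauss a (suc b)) ⊞ gauss (suc a) b) n
    ≡⟨ shift-cong (suc a) (gauss-dual a b) n ⟨
  shift (suc a) (gauss (suc a) (suc b)) n ∎
  where
  open ≡-Reasoning
  open +-*-Solver

-- The defining Pascal rule of `gauss`, read back on alternating sums. In contrast to
-- `altSeries-suc`, its exponents do not depend on `k`, so it survives the limit.
altSeries-pascal : ∀ k s → altSeries (suc k) (suc s) ≗ shift 1 (altSeries k s) ⊞ shift (2 * suc s) (altSeries k (suc s))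
altSeries-pascal k s n with <-cmp s k
... | tri> _ _ k<s = trans (altSeries-large (suc k) (s≤s k<s) n) (sym (cong₂ _⊕_
  (shift-zero 1 n λ {m} _ → altSeries-large k k<s m) (shift-zero (2 * suc s) n λ {m} _ → altSeries-large k (m<n⇒m<1+n k<s) m)))
... | tri≈ _ refl _ = begin
  altSeries (suc s) (suc s) n                              ≡⟨ altSeries-gauss (suc s) (suc s) 0 (+-identityʳ _) n ⟩
  shift (suc s) one n                                      ≡⟨ shift-cong (suc s) (gauss-zeroʳ s) n ⟨
  shift (suc s) (gauss s 0) n                              ≡⟨ shift-+ 1 s (gauss s 0) n ⟨
  shift 1 (shift s (gauss s 0)) n                          ≡⟨ shift-cong 1 (altSeries-gauss s s 0 (+-identityʳ s)) n ⟨
  shift 1 (altSeries s s) n                                ≡⟨ ℙ.+-identityʳ _ ⟨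
  shift 1 (altSeries s s) n ⊕ 0ℙ
    ≡⟨ cong (shift 1 (altSeries s s) n ⊕_) (shift-zero (2 * suc s) n λ {m} _ → altSeries-large s ≤-refl m) ⟨
  shift 1 (altSeries s s) n ⊕ shift (2 * suc s) (altSeries s (suc s)) n ∎
  where open ≡-Reasoning
... | tri< s<k _ _ with b , refl ← m≤n⇒∃[o]m+o≡n s<k = begin
  altSeries (suc (suc s + b)) (suc s) n
    ≡⟨ altSeries-gauss (suc (suc s + b)) (suc s) (suc b) (+-suc (suc s) b) n ⟩
  shift (suc s) (gauss (suc s) (suc b)) n
    ≡⟨ shift-⊞ (suc s) _ _ n ⟩
  shift (suc s) (gauss s (suc b)) n ⊕ shift (suc s) (shift (2 * suc s) (gauss (suc s) b)) n
    ≡⟨ cong₂ _⊕_ (sym (shift-+ 1 s (gauss s (suc b)) n))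
                 (shift-shift {suc s} {2 * suc s} {2 * suc s} {suc s} (gauss (suc s) b) (+-comm (suc s) (2 * suc s)) n) ⟩
  shift 1 (shift s (gauss s (suc b))) n ⊕ shift (2 * suc s) (shift (suc s) (gauss (suc s) b)) n
    ≡⟨ cong₂ _⊕_ (shift-cong 1 (altSeries-gauss (suc s + b) s (suc b) (+-suc s b)) n)
                 (shift-cong (2 * suc s) (altSeries-gauss (suc s + b) (suc s) b refl) n) ⟨
  shift 1 (altSeries (suc s + b) s) n ⊕ shift (2 * suc s) (altSeries (suc s + b) (suc s)) n ∎
  where open ≡-Reasoning

-- The limit of altSeries k s as k → ∞.
altSeries∞ : ℕ → Series
altSeries∞ s n = altSeries n s n

-- Raising the bound past `n` only adds sets with an element larger than `n`, hence of size larger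
-- than `n`.
altSeries-stable : ∀ {k} s {n} → n ≤ k → altSeries k s n ≡ altSeries∞ s n
altSeries-stable {k} s {n} n≤k with m≤n⇒m<n∨m≡n n≤k
... | inj₂ refl = refl
... | inj₁ (s≤s {n = k} n≤k) = trans step (altSeries-stable s n≤k)
  where
  step : altSeries (suc k) s n ≡ altSeries k s n
  step with s ≤? suc k
  ... | no  s≰k = trans (altSeries-large (suc k) (≰⇒> s≰k) n) (sym (altSeries-large k (<-trans ≤-refl (≰⇒> s≰k)) n))
  ... | yes s≤k = trans (altSeries-suc k s≤k n)
    (trans (cong (altSeries k s n ⊕_) (shift-at-< (altSeries k (suc k ∸ s)) (s≤s n≤k))) (ℙ.+-identityʳ _))

shift-altSeries : ∀ a s {k n} → n ≤ k → shift a (altSeries k s) n ≡ shift a (altSeries∞ s) n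
shift-altSeries a s {n = n} n≤k = shift-cong-≤ a n λ m≤n → altSeries-stable s (≤-trans m≤n n≤k)

altSeries∞-zero : altSeries∞ 0 ≗ one
altSeries∞-zero n = altSeries-gauss n 0 n refl n

-- In the limit the two bounds `k + 1` and `k` of `altSeries-pascal` give the same series, so its
-- last term can be moved across.
altSeries∞-suc : ∀ s → T (2 * suc s) (altSeries∞ (suc s)) ≗ shift 1 (altSeries∞ s)
altSeries∞-suc s n = begin
  -- The bound is raised to `suc n` so that `altSeries-pascal` applies.
  altSeries∞ (suc s) n ⊕ x                                 ≡⟨ cong (_⊕ x) (altSeries-stable (suc s) (n≤1+n n)) ⟨
  altSeries (suc n) (suc s) n ⊕ x                          ≡⟨ cong (_⊕ x) (altSeries-pascal n s n) ⟩
  shift 1 (altSeries n s) n ⊕ shift (2 * suc s) (altSeries n (suc s)) n ⊕ x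
    ≡⟨ cong₂ (λ y z → y ⊕ z ⊕ x) (shift-altSeries 1 s {n} ≤-refl) (shift-altSeries (2 * suc s) (suc s) {n} ≤-refl) ⟩
  shift 1 (altSeries∞ s) n ⊕ x ⊕ x                         ≡⟨ ℙ.+-assoc (shift 1 (altSeries∞ s) n) x x ⟩
  shift 1 (altSeries∞ s) n ⊕ (x ⊕ x)                       ≡⟨ cong (shift 1 (altSeries∞ s) n ⊕_) (ℙ.p+p≡0ℙ x) ⟩
  shift 1 (altSeries∞ s) n ⊕ 0ℙ                            ≡⟨ ℙ.+-identityʳ _ ⟩
  shift 1 (altSeries∞ s) n                                 ∎
  where
  open ≡-Reasoning
  x = shift (2 * suc s) (altSeries∞ (suc s)) n

-- (1 + q²)(1 + q⁴)⋯(1 + q^2m) f; modulo 2 this is also multiplication by (q²;q²)ₘ.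
Tprod : ℕ → Series → Series
Tprod zero    f = f
Tprod (suc m) f = T (2 * suc m) (Tprod m f)

Tprod-cong : ∀ m {f g} → f ≗ g → Tprod m f ≗ Tprod m g
Tprod-cong zero    f≗g = f≗g
Tprod-cong (suc m) f≗g = T-cong (2 * suc m) (Tprod-cong m f≗g)

Tprod-shift : ∀ m b f → Tprod m (shift b f) ≗ shift b (Tprod m f)
Tprod-shift zero    b f n = refl
Tprod-shift (suc m) b f n = trans (T-cong (2 * suc m) (Tprod-shift m b f) n) (T-shift (2 * suc m) b (Tprod m f) n)

Tprod-T : ∀ m a f → Tprod m (T a f) ≗ T a (Tprod m f)
Tprod-T zero    a f n = refl
Tprod-T (suc m) a f n = trans (T-cong (2 * suc m) (Tprod-T m a f) n) (T-comm (2 * suc m) a (Tprod m f) n)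

-- This is q^s / (q²;q²)ₛ with the denominator multiplied out; each step clears one factor.
Tprod-altSeries∞ : ∀ s → Tprod s (altSeries∞ s) ≗ shift s one
Tprod-altSeries∞ zero    = altSeries∞-zero
Tprod-altSeries∞ (suc s) n = begin
  T (2 * suc s) (Tprod s (altSeries∞ (suc s))) n ≡⟨ Tprod-T s (2 * suc s) _ n ⟨
  Tprod s (T (2 * suc s) (altSeries∞ (suc s))) n ≡⟨ Tprod-cong s (altSeries∞-suc s) n ⟩
  Tprod s (shift 1 (altSeries∞ s)) n             ≡⟨ Tprod-shift s 1 _ n ⟩
  shift 1 (Tprod s (altSeries∞ s)) n             ≡⟨ shift-cong 1 (Tprod-altSeries∞ s) n ⟩
  shift 1 (shift s one) n                        ≡⟨ shift-+ 1 s one n ⟩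
  shift (suc s) one n                            ∎
  where open ≡-Reasoning

-- The sets are sorted by their largest element `suc i`: the elements below it are free and
-- contribute `Tprod i`. The separate first term is the empty set.
Σᵇ-top : ∀ k (e : ℕ → Series) n →
         Σᵇ k (λ D → shift (2 * size D) (e (top D)) n) ≡
         e 0 n ⊕ Σ< k (λ i → shift (2 * suc i) (Tprod i (e (suc i))) n)
Σᵇ-const : ∀ k f n → Σᵇ k (λ D → shift (2 * size D) f n) ≡ Tprod k f n
Σᵇ-size : ∀ k f n → Σᵇ k (λ D → shift (2 * (suc k + size D)) f n) ≡ shift (2 * suc k) (Tprod k f) n

Σᵇ-const zero    f n = refl
Σᵇ-const (suc k) f n = cong₂ _⊕_ (Σᵇ-const k f n) (Σᵇ-size k f n)

Σᵇ-size k f n = begin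
  Σᵇ k (λ D → shift (2 * (suc k + size D)) f n)
    ≡⟨ Σᵇ-cong k (λ D → trans (cong (λ e → shift e f n) (*-distribˡ-+ 2 (suc k) (size D))) (sym (shift-+ (2 * suc k) (2 * size D) f n))) ⟩
  Σᵇ k (λ D → shift (2 * suc k) (shift (2 * size D) f) n)
    ≡⟨ shift-Σᵇ (2 * suc k) k _ n ⟨
  shift (2 * suc k) (λ m → Σᵇ k (λ D → shift (2 * size D) f m)) n
    ≡⟨ shift-cong (2 * suc k) (Σᵇ-const k f) n ⟩
  shift (2 * suc k) (Tprod k f) n ∎
  where open ≡-Reasoning

Σᵇ-top zero    e n = sym (ℙ.+-identityʳ (e 0 n))
Σᵇ-top (suc k) e n = trans (cong₂ _⊕_ (Σᵇ-top k e n) (Σᵇ-size k (e (suc k)) n)) (ℙ.+-assoc (e 0 n) _ _)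

-- Decomposition of simply paired partitions

Σˡ : ∀ {A : Set} → List A → (A → Parity) → Parity
Σˡ []       w = 0ℙ
Σˡ (x ∷ xs) w = w x ⊕ Σˡ xs w

Σˡ-zero : ∀ {A : Set} (xs : List A) {w} → (∀ x → w x ≡ 0ℙ) → Σˡ xs w ≡ 0ℙ
Σˡ-zero []       w≡0 = refl
Σˡ-zero (x ∷ xs) w≡0 = cong₂ _⊕_ (w≡0 x) (Σˡ-zero xs w≡0)

Σˡ-++ : ∀ {A : Set} (xs ys : List A) w → Σˡ (xs ++ ys) w ≡ Σˡ xs w ⊕ Σˡ ys w
Σˡ-++ []       ys w = refl
Σˡ-++ (x ∷ xs) ys w = trans (cong (w x ⊕_) (Σˡ-++ xs ys w)) (sym (ℙ.+-assoc (w x) _ _))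

Σˡ-map : ∀ {A B : Set} (f : A → B) xs w → Σˡ (map f xs) w ≡ Σˡ xs (w ∘ f)
Σˡ-map f []       w = refl
Σˡ-map f (x ∷ xs) w = cong (w (f x) ⊕_) (Σˡ-map f xs w)

parity-length-filter : ∀ {A : Set} {P : A → Set} (P? : Decidable P) xs → parity (length (filter P? xs)) ≡ Σˡ xs (⟦_⟧ ∘ P?)
parity-length-filter P? []       = refl
parity-length-filter P? (x ∷ xs) with P? x
... | yes _ = trans (ℙ.+-homo-+ 1 (length (filter P? xs))) (cong (1ℙ ⊕_) (parity-length-filter P? xs))
... | no _  = parity-length-filter P? xs

Σˡ-filter : ∀ {A : Set} {P Q : A → Set} (P? : Decidable P) (Q? : Decidable Q) xs →
            Σˡ (filter P? xs) (⟦_⟧ ∘ Q?) ≡ Σˡ xs (λ x → ⟦ Q? x ×-dec P? x ⟧)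
Σˡ-filter P? Q? []       = refl
Σˡ-filter P? Q? (x ∷ xs) with P? x
... | yes p = cong₂ _⊕_ (⟦⟧-cong (Q? x) (Q? x ×-dec yes p) (_, p) proj₁) (Σˡ-filter P? Q? xs)
... | no ¬p = trans (Σˡ-filter P? Q? xs) (cong (_⊕ Σˡ xs _) (sym (⟦⟧-no (Q? x ×-dec no ¬p) (¬p ∘ proj₂))))

filter-cong : ∀ {A : Set} {P Q : A → Set} (P? : Decidable P) (Q? : Decidable Q) {xs} →
              All (λ x → (P x → Q x) × (Q x → P x)) xs → filter P? xs ≡ filter Q? xs
filter-cong P? Q? []                    = refl
filter-cong P? Q? {x ∷ _} ((to , from) ∷ h) with P? x
... | yes p = trans (cong (x ∷_) (filter-cong P? Q? h)) (sym (filter-accept Q? (to p)))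
... | no ¬p = trans (filter-cong P? Q? h) (sym (filter-reject Q? (¬p ∘ from)))

multiplicity-≡ : ∀ x p → multiplicity x (x ∷ p) ≡ suc (multiplicity x p)
multiplicity-≡ x p = cong length (filter-accept (x ≟_) refl)

multiplicity-≢ : ∀ {x y} p → y ≢ x → multiplicity y (x ∷ p) ≡ multiplicity y p
multiplicity-≢ {y = y} p y≢x = cong length (filter-reject (y ≟_) y≢x)

multiplicity-∷ : ∀ x y p → multiplicity y p ≤ multiplicity y (x ∷ p)
multiplicity-∷ x y p with y ≟ x
... | yes refl = ≤-trans (n≤1+n _) (≤-reflexive (sym (multiplicity-≡ x p)))
... | no  y≢x  = ≤-reflexive (sym (multiplicity-≢ p y≢x))

SimplyPaired-tail : ∀ {x p} → SimplyPaired (x ∷ p) → SimplyPaired p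
SimplyPaired-tail {x} {p} (_ ∷ sp) = All.map (λ {y} → ≤-trans (multiplicity-∷ x y p)) sp

-- Since all parts of `q` lie below `x`, a leading block of copies of `x` and the rest `q` do not
-- affect each other's multiplicities.
module _ {x q} (q< : All (_< x) q) where

  multiplicity-block : ∀ j → multiplicity x (replicate j x ++ q) ≡ j
  multiplicity-block zero    = cong length (filter-none (x ≟_) (All.map (λ y<x x≡y → <⇒≢ y<x (sym x≡y)) q<))
  multiplicity-block (suc j) = trans (multiplicity-≡ x (replicate j x ++ q)) (cong suc (multiplicity-block j))

  multiplicity-below : ∀ j {y} → y < x → multiplicity y (replicate j x ++ q) ≡ multiplicity y q
  multiplicity-below zero    y<x = refl
  multiplicity-below (suc j) y<x = trans (multiplicity-≢ (replicate j x ++ q) (<⇒≢ y<x)) (multiplicity-below j y<x)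

  SimplyPaired-block : ∀ {j} → j ≤ 3 → SimplyPaired q → SimplyPaired (replicate j x ++ q)
  SimplyPaired-block {j} j≤3 sp = All.++⁺
    (All.replicate⁺ j (subst (_≤ 3) (sym (multiplicity-block j)) j≤3))
    (All.zipWith (λ (y<x , y≤3) → subst (_≤ 3) (sym (multiplicity-below j y<x)) y≤3) (q< , sp))

  filter-multiplicity : ∀ {P : ℕ → Set} (P? : Decidable P) j →
    All (λ y → (P (multiplicity y (replicate j x ++ q)) → P (multiplicity y q)) ×
               (P (multiplicity y q) → P (multiplicity y (replicate j x ++ q)))) q
  filter-multiplicity {P} P? j = All.map (λ y<x → let eq = multiplicity-below j y<x in subst P eq , subst P (sym eq)) q<

  r-block-< : ∀ {j} → j < 2 → r (replicate j x ++ q) ≡ r q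
  r-block-< {j} j<2 = cong (max 0) (begin
    filter (λ y → 2 ≤? multiplicity y p) p
      ≡⟨ filter-++ (λ y → 2 ≤? multiplicity y p) (replicate j x) q ⟩
    filter (λ y → 2 ≤? multiplicity y p) (replicate j x) ++ filter (λ y → 2 ≤? multiplicity y p) q
      ≡⟨ cong₂ _++_ (filter-none (λ y → 2 ≤? multiplicity y p)
                      (All.replicate⁺ j λ 2≤ → <⇒≱ j<2 (subst (2 ≤_) (multiplicity-block j) 2≤)))
                    (filter-cong (λ y → 2 ≤? multiplicity y p) (λ y → 2 ≤? multiplicity y q) (filter-multiplicity (2 ≤?_) j)) ⟩
    filter (λ y → 2 ≤? multiplicity y q) q ∎)
    where
    open ≡-Reasoning
    p = replicate j x ++ q

  r-block-≥ : ∀ {j} → 2 ≤ j → r (replicate j x ++ q) ≡ x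
  r-block-≥ {suc j} 2≤j = max≈v⁺
    (∈-filter⁺ (λ y → 2 ≤? multiplicity y p) (here refl) (subst (2 ≤_) (sym (multiplicity-block (suc j))) 2≤j))
    (All.filter⁺ (λ y → 2 ≤? multiplicity y p) (All.++⁺ (All.replicate⁺ (suc j) ≤-refl) (All.map <⇒≤ q<)))
    z≤n
    where
    p = replicate (suc j) x ++ q

  deduplicate-block : ∀ j → deduplicate _≟_ (replicate (suc j) x ++ q) ≡ x ∷ deduplicate _≟_ q
  deduplicate-block zero    = cong (x ∷_) (filter-all (¬? ∘ (x ≟_))
    (All.map (λ y<x x≡y → <⇒≢ y<x (sym x≡y)) (All.deduplicate⁺ _≟_ q<)))
  deduplicate-block (suc j) = cong (x ∷_) (begin
    filter (¬? ∘ (x ≟_)) (deduplicate _≟_ (replicate (suc j) x ++ q)) ≡⟨ cong (filter (¬? ∘ (x ≟_))) (deduplicate-block j) ⟩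
    filter (¬? ∘ (x ≟_)) (x ∷ deduplicate _≟_ q)   ≡⟨ filter-reject (¬? ∘ (x ≟_)) (λ x≢x → x≢x refl) ⟩
    filter (¬? ∘ (x ≟_)) (deduplicate _≟_ q)
      ≡⟨ filter-all (¬? ∘ (x ≟_)) (All.map (λ y<x x≡y → <⇒≢ y<x (sym x≡y)) (All.deduplicate⁺ _≟_ q<)) ⟩
    deduplicate _≟_ q                              ∎)
    where open ≡-Reasoning

  oddSizes-rest : ∀ j → filter (λ y → multiplicity y (replicate j x ++ q) % 2 ≟ 1) (deduplicate _≟_ q) ≡ oddSizes q
  oddSizes-rest j = filter-cong (λ y → multiplicity y (replicate j x ++ q) % 2 ≟ 1) (λ y → multiplicity y q % 2 ≟ 1)
    (All.deduplicate⁺ _≟_ (filter-multiplicity (λ m → m % 2 ≟ 1) j))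

  oddSizes-odd : ∀ {j} → j % 2 ≡ 1 → oddSizes (replicate j x ++ q) ≡ x ∷ oddSizes q
  oddSizes-odd {suc j} odd = begin
    filter O? (deduplicate _≟_ (replicate (suc j) x ++ q)) ≡⟨ cong (filter O?) (deduplicate-block j) ⟩
    filter O? (x ∷ deduplicate _≟_ q)                ≡⟨ filter-accept O? {x} {deduplicate _≟_ q} (trans (cong (_% 2) (multiplicity-block (suc j))) odd) ⟩
    x ∷ filter O? (deduplicate _≟_ q)                ≡⟨ cong (x ∷_) (oddSizes-rest (suc j)) ⟩
    x ∷ oddSizes q                                   ∎
    where
    open ≡-Reasoning
    O? = λ y → multiplicity y (replicate (suc j) x ++ q) % 2 ≟ 1

  oddSizes-even : ∀ {j} → j % 2 ≢ 1 → oddSizes (replicate j x ++ q) ≡ oddSizes q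
  oddSizes-even {zero}  even = refl
  oddSizes-even {suc j} even = begin
    filter O? (deduplicate _≟_ (replicate (suc j) x ++ q)) ≡⟨ cong (filter O?) (deduplicate-block j) ⟩
    filter O? (x ∷ deduplicate _≟_ q)
      ≡⟨ filter-reject O? {x} {deduplicate _≟_ q} (λ odd → even (trans (sym (cong (_% 2) (multiplicity-block (suc j)))) odd)) ⟩
    filter O? (deduplicate _≟_ q)                    ≡⟨ oddSizes-rest (suc j) ⟩
    oddSizes q                                       ∎
    where
    open ≡-Reasoning
    O? = λ y → multiplicity y (replicate (suc j) x ++ q) % 2 ≟ 1

-- `u` and `d` are the binary digits of a multiplicity: each of 0, 1, 2, 3 occurs exactly once,
-- which is where the bound 3 enters.
copies : Bool → Bool → ℕ
copies u d = (if u then 1 else 0) + (if d then 2 else 0)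

copies≤3 : ∀ u d → copies u d ≤ 3
copies≤3 false false = z≤n
copies≤3 false true  = s≤s (s≤s z≤n)
copies≤3 true  false = s≤s z≤n
copies≤3 true  true  = ≤-refl

decode : ∀ {k} → Vec Bool k → Vec Bool k → List ℕ
decode {zero}  []      []      = []
decode {suc k} (u ∷ U) (d ∷ D) = replicate (copies u d) (suc k) ++ decode U D

decode≤ : ∀ {k} (U D : Vec Bool k) → All (_< suc k) (decode U D)
decode≤ {zero}  []      []      = []
decode≤ {suc k} (u ∷ U) (d ∷ D) = All.++⁺ (All.replicate⁺ (copies u d) ≤-refl) (All.map m<n⇒m<1+n (decode≤ U D))

SimplyPaired-decode : ∀ {k} (U D : Vec Bool k) → SimplyPaired (decode U D)
SimplyPaired-decode {zero}  []      []      = []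
SimplyPaired-decode {suc k} (u ∷ U) (d ∷ D) = SimplyPaired-block (decode≤ U D) (copies≤3 u d) (SimplyPaired-decode U D)

sum-decode : ∀ {k} (U D : Vec Bool k) → sum (decode U D) ≡ 2 * size D + size U
sum-decode {zero}  []          []          = refl
sum-decode {suc k} (false ∷ U) (false ∷ D) = sum-decode U D
sum-decode {suc k} (true  ∷ U) (false ∷ D) = trans (cong (_+_ (suc k)) (sum-decode U D))
  (solve 3 (λ k d u → k :+ (con 2 :* d :+ u) := con 2 :* d :+ (k :+ u)) refl (suc k) (size D) (size U))
  where open +-*-Solver
sum-decode {suc k} (false ∷ U) (true  ∷ D) = trans (cong (λ t → suc k + (suc k + t)) (sum-decode U D))
  (solve 3 (λ k d u → k :+ (k :+ (con 2 :* d :+ u)) := con 2 :* (k :+ d) :+ u) refl (suc k) (size D) (size U))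
  where open +-*-Solver
sum-decode {suc k} (true  ∷ U) (true  ∷ D) = trans (cong (λ t → suc k + (suc k + (suc k + t))) (sum-decode U D))
  (solve 3 (λ k d u → k :+ (k :+ (k :+ (con 2 :* d :+ u))) := con 2 :* (k :+ d) :+ (k :+ u)) refl (suc k) (size D) (size U))
  where open +-*-Solver

r-decode : ∀ {k} (U D : Vec Bool k) → r (decode U D) ≡ top D
r-decode {zero}  []          []          = refl
r-decode {suc k} (false ∷ U) (false ∷ D) = r-decode U D
r-decode {suc k} (true  ∷ U) (false ∷ D) = trans (r-block-< (decode≤ U D) {1} (s≤s (s≤s z≤n))) (r-decode U D)
r-decode {suc k} (false ∷ U) (true  ∷ D) = r-block-≥ (decode≤ U D) {2} (s≤s (s≤s z≤n))
r-decode {suc k} (true  ∷ U) (true  ∷ D) = r-block-≥ (decode≤ U D) {3} (s≤s (s≤s z≤n))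

s-decode : ∀ {k} (U D : Vec Bool k) → s (decode U D) ≡ + alt U
s-decode {zero}  []          []      = refl
s-decode {suc k} (false ∷ U) (d ∷ D) = trans (cong alternatingSum (oddSizes-even (decode≤ U D) {copies false d} (even d))) (s-decode U D)
  where
  even : ∀ d → copies false d % 2 ≢ 1
  even false ()
  even true  ()
s-decode {suc k} (true  ∷ U) (d ∷ D) = begin
  alternatingSum (oddSizes (replicate (copies true d) (suc k) ++ decode U D))
    ≡⟨ cong alternatingSum (oddSizes-odd (decode≤ U D) {copies true d} (odd d)) ⟩
  + suc k ℤ.- s (decode U D)  ≡⟨ cong (λ t → + suc k ℤ.- t) (s-decode U D) ⟩
  + suc k ℤ.- + alt U         ≡⟨ ℤ.m-n≡m⊖n (suc k) (alt U) ⟩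
  suc k ℤ.⊖ alt U             ≡⟨ ℤ.⊖-≥ (m≤n⇒m≤1+n (alt≤ U)) ⟩
  + (suc k ∸ alt U)           ∎
  where
  open ≡-Reasoning
  odd : ∀ d → copies true d % 2 ≡ 1
  odd false = refl
  odd true  = refl

-- Sums over boxes as sums over pairs of sets

Σ-decode : ∀ k → (List ℕ → Parity) → Parity
Σ-decode k w = Σᵇ k λ U → Σᵇ k λ D → w (decode U D)

Σ-decode-zero : ∀ k {w} → (∀ p → w p ≡ 0ℙ) → Σ-decode k w ≡ 0ℙ
Σ-decode-zero k w≡0 = Σᵇ-zero k λ U → Σᵇ-zero k λ D → w≡0 (decode U D)

-- Zero to `j` copies of `suc k` in front of a decoded pair. It mediates between `box`, which emits
-- one part at a time, and `decode`, which emits whole blocks.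
Σ-peel : ℕ → ℕ → (List ℕ → Parity) → Parity
Σ-peel zero    k w = Σ-decode k w
Σ-peel (suc j) k w = Σ-decode k w ⊕ Σ-peel j k (w ∘ (suc k ∷_))

Σ-peel-zero : ∀ j k {w} → (∀ p → w p ≡ 0ℙ) → Σ-peel j k w ≡ 0ℙ
Σ-peel-zero zero    k w≡0 = Σ-decode-zero k w≡0
Σ-peel-zero (suc j) k w≡0 = cong₂ _⊕_ (Σ-decode-zero k w≡0) (Σ-peel-zero j k (w≡0 ∘ (suc k ∷_)))

Σ-peel-decode : ∀ k w → Σ-peel 3 k w ≡ Σ-decode (suc k) w
Σ-peel-decode k w = begin
  -- An absent `suc k` in U gives the multiplicities 0 and 2, a present one 1 and 3.
  Y 0 ⊕ (Y 1 ⊕ (Y 2 ⊕ Y 3))   ≡⟨ solve 4 (λ a b c d → a :+ (b :+ (c :+ d)) := (a :+ c) :+ (b :+ d)) refl (Y 0) (Y 1) (Y 2) (Y 3) ⟩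
  (Y 0 ⊕ Y 2) ⊕ (Y 1 ⊕ Y 3)   ≡⟨ cong₂ _⊕_ (Σᵇ-⊕ k _ _) (Σᵇ-⊕ k _ _) ⟨
  Σ-decode (suc k) w          ∎
  where
  open ≡-Reasoning
  open ℙ-Solver
  Y : ℕ → Parity
  Y j = Σ-decode k (λ p → w (replicate j (suc k) ++ p))

-- The weights for which summing over box l k and over all pairs (U, D) agree.
record Supported (l : ℕ) (w : List ℕ → Parity) : Set where
  field
    short  : ∀ {p} → l < length p → w p ≡ 0ℙ
    paired : ∀ {p} → ¬ SimplyPaired p → w p ≡ 0ℙ

open Supported

Supported-∷ : ∀ {l w} x → Supported (suc l) w → Supported l (w ∘ (x ∷_))
Supported-∷ x sup .short  l<  = sup .short (s≤s l<)
Supported-∷ x sup .paired ¬sp = sup .paired (¬sp ∘ SimplyPaired-tail)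

-- The box also contains lists with a part repeated four or more times, and it stops at length `l`
-- where pairs do not; a supported weight vanishes on both kinds of excess. At most three copies of
-- the largest part are peeled off, and a fourth one gives weight 0.
Σ-box : ∀ k l {w} → Supported l w → Σˡ (box l k) w ≡ Σ-decode k w
Σ-box zero    zero    {w} sup = ℙ.+-identityʳ (w [])
Σ-box zero    (suc l) {w} sup = ℙ.+-identityʳ (w [])
Σ-box (suc k) l       {w} sup = trans (peel 3 l sup λ p → sup .paired (fourfold p)) (Σ-peel-decode k w)
  where
  fourfold : ∀ p → ¬ SimplyPaired (replicate 4 (suc k) ++ p)
  fourfold p (≤3 ∷ _) = <⇒≱ {3} ≤-refl (≤-trans (≤-trans (m≤m+n 4 _) (≤-reflexive (sym (count 4)))) ≤3)
    where
    count : ∀ j → multiplicity (suc k) (replicate j (suc k) ++ p) ≡ j + multiplicity (suc k) p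
    count zero    = refl
    count (suc j) = trans (multiplicity-≡ (suc k) (replicate j (suc k) ++ p)) (cong suc (count j))
  peel : ∀ j l {w} → Supported l w → (∀ p → w (replicate (suc j) (suc k) ++ p) ≡ 0ℙ) → Σˡ (box l (suc k)) w ≡ Σ-peel j k w
  peel zero    zero    sup j< = Σ-box k zero sup
  -- No room for a further part is left: the pairs that would use one are too long and have weight
  -- 0.
  peel (suc j) zero    {w} sup j< = trans (Σ-box k zero sup)
    (sym (trans (cong (Σ-decode k w ⊕_) (Σ-peel-zero j k λ p → sup .short (s≤s z≤n))) (ℙ.+-identityʳ _)))
  peel zero    (suc l) {w} sup j< = trans (Σˡ-++ (map (suc k ∷_) (box l (suc k))) _ w)
    (cong₂ _⊕_ (trans (Σˡ-map (suc k ∷_) (box l (suc k)) w) (Σˡ-zero (box l (suc k)) j<)) (Σ-box k (suc l) sup))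
  peel (suc j) (suc l) {w} sup j< = trans (Σˡ-++ (map (suc k ∷_) (box l (suc k))) _ w)
    (trans (cong₂ _⊕_ (trans (Σˡ-map (suc k ∷_) (box l (suc k)) w) (peel j l (Supported-∷ (suc k) sup) j<)) (Σ-box k (suc l) sup))
           (ℙ.+-comm (Σ-peel j k (w ∘ (suc k ∷_))) _))

-- The generating function of `A₂` modulo 2

positive? : ∀ p → Dec (All (0 <_) p)
positive? = all? (0 <?_)

length≤sum : ∀ {p} → All (0 <_) p → length p ≤ sum p
length≤sum []          = z≤n
length≤sum (0<x ∷ pos) = +-mono-≤ 0<x (length≤sum pos)

decode-positive : ∀ {k} (U D : Vec Bool k) → All (0 <_) (decode U D)
decode-positive {zero}  []      []      = []
decode-positive {suc k} (u ∷ U) (d ∷ D) = All.++⁺ (All.replicate⁺ (copies u d) (s≤s z≤n)) (decode-positive U D)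

Σˡ-cong : ∀ {A : Set} {xs : List A} {v w} → All (λ x → v x ≡ w x) xs → Σˡ xs v ≡ Σˡ xs w
Σˡ-cong []       = refl
Σˡ-cong (h ∷ hs) = cong₂ _⊕_ h (Σˡ-cong hs)

pairingRank-decode : ∀ {k} (U D : Vec Bool k) → pairingRank (decode U D) ≡ ℤ.- + 2 → alt U ≡ top D + 2
pairingRank-decode U D eq = ℤ.+-injective (begin
  + alt U                              ≡⟨ ℤ.neg-involutive (+ alt U) ⟨
  ℤ.- (ℤ.- + alt U)                    ≡⟨ cong (ℤ.-_) (ℤ.+-identityˡ (ℤ.- + alt U)) ⟨
  ℤ.- (+ 0 ℤ.- + alt U)                ≡⟨ cong (λ t → ℤ.- (t ℤ.- + alt U)) (ℤ.+-inverseˡ (+ top D)) ⟨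
  ℤ.- (ℤ.- + top D ℤ.+ + top D ℤ.- + alt U) ≡⟨ cong (ℤ.-_) (ℤ.+-assoc (ℤ.- + top D) _ _) ⟩
  ℤ.- (ℤ.- + top D ℤ.+ (+ top D ℤ.- + alt U))
    ≡⟨ cong (λ t → ℤ.- (ℤ.- + top D ℤ.+ t)) (trans (cong₂ (λ a b → + a ℤ.- b) (sym (r-decode U D)) (sym (s-decode U D))) eq) ⟩
  ℤ.- (ℤ.- + top D ℤ.- + 2)            ≡⟨ ℤ.neg-distrib-+ (ℤ.- + top D) (ℤ.- + 2) ⟩
  ℤ.- (ℤ.- + top D) ℤ.+ + 2            ≡⟨ cong (ℤ._+ + 2) (ℤ.neg-involutive (+ top D)) ⟩
  + (top D + 2)                        ∎)
  where open ≡-Reasoning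

decode-pairingRank : ∀ {k} (U D : Vec Bool k) → alt U ≡ top D + 2 → pairingRank (decode U D) ≡ ℤ.- + 2
decode-pairingRank U D eq = begin
  + r (decode U D) ℤ.- s (decode U D)  ≡⟨ cong₂ (λ a b → + a ℤ.- b) (r-decode U D) (trans (s-decode U D) (cong +_ eq)) ⟩
  + top D ℤ.- + (top D + 2)            ≡⟨ cong (λ t → + top D ℤ.+ t) (ℤ.neg-distrib-+ (+ top D) (+ 2)) ⟩
  + top D ℤ.+ (ℤ.- + top D ℤ.- + 2)    ≡⟨ ℤ.+-assoc (+ top D) (ℤ.- + top D) (ℤ.- + 2) ⟨
  + top D ℤ.- + top D ℤ.- + 2          ≡⟨ cong (ℤ._- + 2) (ℤ.+-inverseʳ (+ top D)) ⟩
  ℤ.- + 2                              ∎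
  where open ≡-Reasoning

-- The pairs (U, D) with max D = i + 1.
rankSeries : ℕ → Series
rankSeries i = shift (2 * suc i) (Tprod i (altSeries∞ (3 + i)))

-- The first term is the case of distinct parts: D is empty, r = 0 and s = 2.
parity-A₂ : ∀ n → parity (A₂ n) ≡ altSeries∞ 2 n ⊕ Σ< n (λ i → rankSeries i n)
parity-A₂ n = begin
  parity (A₂ n)
    ≡⟨ parity-length-filter Q? (partitions n) ⟩
  Σˡ (partitions n) (⟦_⟧ ∘ Q?)
    -- Positivity is built into the weight because it bounds the length of a list by its sum, and
    -- `short` demands this for arbitrary lists.
    ≡⟨ Σˡ-cong {xs = partitions n} (All.tabulate λ {p} p∈ → ⟦⟧-cong (Q? p) (Q? p ×-dec positive? p)
         (_, IsPartition.positive (∈-partitions⁻ {n} p∈)) proj₁) ⟩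
  Σˡ (partitions n) (λ p → ⟦ Q? p ×-dec positive? p ⟧)
    ≡⟨ Σˡ-filter (λ p → sum p ≟ n) (λ p → Q? p ×-dec positive? p) (box n n) ⟩
  Σˡ (box n n) (⟦_⟧ ∘ W?)
    ≡⟨ Σ-box n n supported ⟩
  Σᵇ n (λ U → Σᵇ n λ D → ⟦ W? (decode U D) ⟧)
    ≡⟨ Σᵇ-cong n (λ U → Σᵇ-cong n λ D → ⟦⟧-cong (W? (decode U D)) ((alt U ≟ top D + 2) ×-dec (2 * size D + size U ≟ n))
         (λ (((_ , rank) , _) , eq) → pairingRank-decode U D rank , trans (sym (sum-decode U D)) eq)
         (λ (rank , eq) → ((SimplyPaired-decode U D , decode-pairingRank U D rank) , decode-positive U D) , trans (sum-decode U D) eq)) ⟩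
  Σᵇ n (λ U → Σᵇ n λ D → ⟦ (alt U ≟ top D + 2) ×-dec (2 * size D + size U ≟ n) ⟧)
    -- D goes outside, since its maximum prescribes the alternating sum of U.
    ≡⟨ Σᵇ-swap n n _ ⟩
  Σᵇ n (λ D → Σᵇ n λ U → ⟦ (alt U ≟ top D + 2) ×-dec (2 * size D + size U ≟ n) ⟧)
    ≡⟨ Σᵇ-cong n (λ D → Σᵇ-cong n λ U → monomial-shift (alt U ≟ top D + 2) (2 * size D) (size U) n) ⟨
  Σᵇ n (λ D → Σᵇ n λ U → shift (2 * size D) (λ m → ⟦ (alt U ≟ top D + 2) ×-dec (size U ≟ m) ⟧) n)
    ≡⟨ Σᵇ-cong n (λ D → shift-Σᵇ (2 * size D) n _ n) ⟨
  Σᵇ n (λ D → shift (2 * size D) (altSeries n (top D + 2)) n)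
    ≡⟨ Σᵇ-cong n (λ D → trans (shift-altSeries (2 * size D) (top D + 2) {n} ≤-refl)
         (cong (λ e → shift (2 * size D) (altSeries∞ e) n) (+-comm (top D) 2))) ⟩
  Σᵇ n (λ D → shift (2 * size D) (altSeries∞ (2 + top D)) n)
    ≡⟨ Σᵇ-top n (altSeries∞ ∘ _+_ 2) n ⟩
  altSeries∞ 2 n ⊕ Σ< n (λ i → rankSeries i n) ∎
  where
  open ≡-Reasoning
  Q? = λ p → simplyPaired? p ×-dec (pairingRank p ℤ.≟ ℤ.- (+ 2))
  W? = λ p → (Q? p ×-dec positive? p) ×-dec (sum p ≟ n)
  supported : Supported n (⟦_⟧ ∘ W?)
  supported .Supported.short {p} n<l = ⟦⟧-no (W? p) λ ((_ , pos) , eq) →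
    <⇒≱ n<l (≤-trans (length≤sum pos) (≤-reflexive eq))
  supported .Supported.paired {p} ¬sp = ⟦⟧-no (W? p) λ (((sp , _) , _) , _) → ¬sp sp

-- Lambert series

-- The geometric series 1 / (1 - q^a).
multiples : ℕ → Series
multiples a n = ⟦ a ∣? n ⟧

T-multiples : ∀ a .{{_ : NonZero a}} → T a (multiples a) ≗ one
T-multiples a n with n <? a
... | yes n<a = trans (cong (multiples a n ⊕_) (shift-at-< (multiples a) n<a)) (trans (ℙ.+-identityʳ _) (small n n<a))
  where
  small : ∀ n → n < a → multiples a n ≡ one n
  small zero    _   = ⟦⟧-yes (a ∣? 0) (a ∣0)
  small (suc n) n<a = ⟦⟧-no (a ∣? suc n) λ a∣n → <⇒≱ n<a (∣⇒≤ a∣n)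
T-multiples a@(suc _) n | no n≮a with m , refl ← m≤n⇒∃[o]m+o≡n (≮⇒≥ n≮a) = begin
  multiples a (a + m) ⊕ shift a (multiples a) (a + m)
    ≡⟨ cong₂ _⊕_ (⟦⟧-cong (a ∣? (a + m)) (a ∣? m) (λ d → ∣m+n∣m⇒∣n d ∣-refl) (∣m∣n⇒∣m+n ∣-refl)) (shift-at-+ a _ m) ⟩
  multiples a m ⊕ multiples a m ≡⟨ ℙ.p+p≡0ℙ (multiples a m) ⟩
  0ℙ ∎
  where open ≡-Reasoning

-- Recognises q^b / (1 - q^a) from its product with the denominator, by `T-injective`.
T-multiples-shift : ∀ a .{{_ : NonZero a}} b f → T a f ≗ shift b one → f ≗ shift b (multiples a)
T-multiples-shift a b f eq = T-injective a λ n → trans (eq n)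
  (sym (trans (T-shift a b (multiples a) n) (shift-cong b (T-multiples a) n)))

-- q^3r / (1 - q^2r)
lambert : ℕ → Series
lambert r = shift (3 * r) (multiples (2 * r))

-- The factor `Tprod i` supplied by D and the three outer factors together form `Tprod (3 + i)`, the
-- whole denominator of `altSeries∞ (3 + i)`. The exponents add up to 2r + (r + 2) with r = `suc i`.
rankSeries-T : ∀ i → T (2 * (3 + i)) (T (2 * (2 + i)) (T (2 * suc i) (rankSeries i))) ≗ shift (5 + 3 * i) one
rankSeries-T i n = begin
  T (2 * (3 + i)) (T (2 * (2 + i)) (T (2 * suc i) (shift (2 * suc i) (Tprod i (altSeries∞ (3 + i)))))) n
    ≡⟨ T-cong (2 * (3 + i)) (T-cong (2 * (2 + i)) (T-shift (2 * suc i) (2 * suc i) (Tprod i (altSeries∞ (3 + i))))) n ⟩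
  T (2 * (3 + i)) (T (2 * (2 + i)) (shift (2 * suc i) (Tprod (suc i) (altSeries∞ (3 + i))))) n
    ≡⟨ T-cong (2 * (3 + i)) (T-shift (2 * (2 + i)) (2 * suc i) (Tprod (1 + i) (altSeries∞ (3 + i)))) n ⟩
  T (2 * (3 + i)) (shift (2 * suc i) (Tprod (2 + i) (altSeries∞ (3 + i)))) n
    ≡⟨ T-shift (2 * (3 + i)) (2 * suc i) (Tprod (2 + i) (altSeries∞ (3 + i))) n ⟩
  shift (2 * suc i) (Tprod (3 + i) (altSeries∞ (3 + i))) n
    ≡⟨ shift-cong (2 * suc i) (Tprod-altSeries∞ (3 + i)) n ⟩
  shift (2 * suc i) (shift (3 + i) one) n
    ≡⟨ shift-+ (2 * suc i) (3 + i) one n ⟩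
  shift (2 * suc i + (3 + i)) one n
    ≡⟨ cong (λ e → shift e one n) (solve 1 (λ i → con 2 :* (con 1 :+ i) :+ (con 3 :+ i) := con 5 :+ con 3 :* i) refl i) ⟩
  shift (5 + 3 * i) one n ∎
  where
  open ≡-Reasoning
  open +-*-Solver

-- Partial fractions of q^(3r+2) / ((1 - q^2r)(1 - q^(2r+2))(1 - q^(2r+4))), r = i + 1.
rankSeries-partialFractions : ∀ i → T 2 (T 4 (rankSeries i)) ≗
  (shift 2 (lambert (1 + i)) ⊞ shift 1 (lambert (2 + i))) ⊞ (shift 3 (lambert (2 + i)) ⊞ shift 2 (lambert (3 + i)))
rankSeries-partialFractions i n = begin
  T 2 (T 4 (rankSeries i)) n
    ≡⟨ T-cong 2 (λ m → trans (T-split x 4 (rankSeries i) m) (cong (λ e → T e (rankSeries i) m ⊕ shift 4 P′ m) x+4)) n ⟩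
  T 2 (P ⊞ shift 4 P′) n
    ≡⟨ trans (T-⊞ 2 P (shift 4 P′) n) (cong (T 2 P n ⊕_) (T-shift 2 4 P′ n)) ⟩
  T 2 P n ⊕ shift 4 (T 2 P′) n
    ≡⟨ cong₂ _⊕_ TP (trans (shift-cong 4 TP′ n) (shift-⊞ 4 _ _ n)) ⟩
  (shift c (multiples x) n ⊕ shift 2 (shift c (multiples y)) n) ⊕
  (shift 4 (shift c (multiples y)) n ⊕ shift 4 (shift 2 (shift c (multiples z))) n)
    ≡⟨ cong₂ _⊕_
         (cong₂ _⊕_ (trans (cong (λ e → shift e (multiples x) n) (solve 1 (λ i → con 5 :+ con 3 :* i := con 2 :+ con 3 :* (con 1 :+ i)) refl i)) (sym (shift-+ 2 (3 * (1 + i)) (multiples x) n)))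
                    (shift-shift {2} {c} {1} {3 * (2 + i)} (multiples y) (solve 1 (λ i → con 2 :+ (con 5 :+ con 3 :* i) := con 1 :+ con 3 :* (con 2 :+ i)) refl i) n))
         (cong₂ _⊕_ (shift-shift {4} {c} {3} {3 * (2 + i)} (multiples y) (solve 1 (λ i → con 4 :+ (con 5 :+ con 3 :* i) := con 3 :+ con 3 :* (con 2 :+ i)) refl i) n)
                    (trans (shift-+ 4 2 (shift c (multiples z)) n)
                           (shift-shift {6} {c} {2} {3 * (3 + i)} (multiples z) (solve 1 (λ i → con 6 :+ (con 5 :+ con 3 :* i) := con 2 :+ con 3 :* (con 3 :+ i)) refl i) n))) ⟩
  (shift 2 (lambert (1 + i)) n ⊕ shift 1 (lambert (2 + i)) n) ⊕ (shift 3 (lambert (2 + i)) n ⊕ shift 2 (lambert (3 + i)) n) ∎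
  where
  open ≡-Reasoning
  open +-*-Solver
  -- The exponents of the three denominators; `z` - `x` is 4, and both gaps next to `y` are 2. The
  -- numerator is q^c with c = 3r + 2.
  x = 2 * (1 + i)
  y = 2 * (2 + i)
  z = 2 * (3 + i)
  c = 5 + 3 * i
  -- `P` has only the denominators for `x` and `y` left, `P′` those for `y` and `z`; multiplication
  -- by 1 + q² splits each of them.
  P = T z (rankSeries i)
  P′ = T x (rankSeries i)
  x+2 : x + 2 ≡ y
  x+2 = solve 1 (λ i → con 2 :* (con 1 :+ i) :+ con 2 := con 2 :* (con 2 :+ i)) refl i
  y+2 : y + 2 ≡ z
  y+2 = solve 1 (λ i → con 2 :* (con 2 :+ i) :+ con 2 := con 2 :* (con 3 :+ i)) refl i
  x+4 : x + 4 ≡ z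
  x+4 = solve 1 (λ i → con 2 :* (con 1 :+ i) :+ con 4 := con 2 :* (con 3 :+ i)) refl i
  zyx : T z (T y P′) ≗ shift c one
  zyx = rankSeries-T i
  yxz : T y (T x P) ≗ shift c one
  yxz m = trans (T-cong y (T-comm x z (rankSeries i)) m) (trans (T-comm y z P′ m) (zyx m))
  TP : T 2 P n ≡ shift c (multiples x) n ⊕ shift 2 (shift c (multiples y)) n
  TP = trans (T-split x 2 P n) (cong₂ _⊕_
    (trans (cong (λ e → T e P n) x+2) (T-multiples-shift x c (T y P) (λ m → trans (T-comm x y P m) (yxz m)) n))
    (shift-cong 2 (T-multiples-shift y c (T x P) yxz) n))
  TP′ : T 2 P′ ≗ shift c (multiples y) ⊞ shift 2 (shift c (multiples z))
  TP′ m = trans (T-split y 2 P′ m) (cong₂ _⊕_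
    (trans (cong (λ e → T e P′ m) y+2) (T-multiples-shift y c (T z P′) (λ k → trans (T-comm y z P′ k) (zyx k)) m))
    (shift-cong 2 (T-multiples-shift z c (T y P′) zyx) m))

Λ : Series
Λ n = Σ< n λ j → lambert (suc j) n

lambert-vanish : ∀ {r n} → n < r → lambert r n ≡ 0ℙ
lambert-vanish {r} n<r = shift-at-< (multiples (2 * r)) (<-≤-trans n<r (m≤n*m r 3))

Λ-stable : ∀ {k n} → n ≤ k → Σ< k (λ j → lambert (suc j) n) ≡ Λ n
Λ-stable n≤k = Σ<-extend n≤k λ i n≤i → lambert-vanish (s≤s n≤i)

-- Modulo 2, removing a term from a sum is the same as adding it once more.
Λ-tail₁ : ∀ {k n} → n ≤ k → Σ< k (λ j → lambert (2 + j) n) ≡ lambert 1 n ⊕ Λ n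
Λ-tail₁ {k} {n} n≤k = begin
  Σ< k (λ j → lambert (2 + j) n)                      ≡⟨ cong (_⊕ Σ< k (λ j → lambert (2 + j) n)) (ℙ.p+p≡0ℙ (lambert 1 n)) ⟨
  lambert 1 n ⊕ lambert 1 n ⊕ Σ< k (λ j → lambert (2 + j) n) ≡⟨ ℙ.+-assoc (lambert 1 n) _ _ ⟩
  lambert 1 n ⊕ (lambert 1 n ⊕ Σ< k (λ j → lambert (2 + j) n)) ≡⟨ cong (lambert 1 n ⊕_) (Σ<-suc k (λ j → lambert (suc j) n)) ⟨
  lambert 1 n ⊕ Σ< (suc k) (λ j → lambert (suc j) n)  ≡⟨ cong (lambert 1 n ⊕_) (Λ-stable (m≤n⇒m≤1+n n≤k)) ⟩
  lambert 1 n ⊕ Λ n                                   ∎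
  where open ≡-Reasoning

Λ-tail₂ : ∀ {k n} → n ≤ k → Σ< k (λ j → lambert (3 + j) n) ≡ lambert 2 n ⊕ (lambert 1 n ⊕ Λ n)
Λ-tail₂ {k} {n} n≤k = begin
  Σ< k (λ j → lambert (3 + j) n)                      ≡⟨ cong (_⊕ Σ< k (λ j → lambert (3 + j) n)) (ℙ.p+p≡0ℙ (lambert 2 n)) ⟨
  lambert 2 n ⊕ lambert 2 n ⊕ Σ< k (λ j → lambert (3 + j) n) ≡⟨ ℙ.+-assoc (lambert 2 n) _ _ ⟩
  lambert 2 n ⊕ (lambert 2 n ⊕ Σ< k (λ j → lambert (3 + j) n)) ≡⟨ cong (lambert 2 n ⊕_) (Σ<-suc k (λ j → lambert (2 + j) n)) ⟨
  lambert 2 n ⊕ Σ< (suc k) (λ j → lambert (2 + j) n)  ≡⟨ cong (lambert 2 n ⊕_) (Λ-tail₁ (m≤n⇒m≤1+n n≤k)) ⟩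
  lambert 2 n ⊕ (lambert 1 n ⊕ Λ n)                   ∎
  where open ≡-Reasoning

Σ<-shift : ∀ a n (F : ℕ → Series) g → (∀ {m} → m ≤ n → Σ< n (λ i → F i m) ≡ g m) → Σ< n (λ i → shift a (F i) n) ≡ shift a g n
Σ<-shift a n F g h = trans (sym (shift-Σ< a n F n)) (shift-cong-≤ a n h)

-- The two copies of q²Λ cancel, so this is (q + q³)Λ plus q² and shifts of `lambert 1` and
-- `lambert 2`. It is left uncollected, term by term as the partial fractions deliver it.
lambertSide : Series
lambertSide =
  shift 2 one ⊞ ((shift 2 Λ ⊞ shift 1 (lambert 1 ⊞ Λ)) ⊞ (shift 3 (lambert 1 ⊞ Λ) ⊞ shift 2 (lambert 2 ⊞ (lambert 1 ⊞ Λ))))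

T2T4-A₂ : T 2 (T 4 (parity ∘ A₂)) ≗ lambertSide
T2T4-A₂ n = begin
  T 2 (T 4 (parity ∘ A₂)) n
    -- The number of summands in `parity-A₂` varies with the coefficient; all are padded to `n`
    -- summands so that `T` passes through one fixed finite sum.
    ≡⟨ T-cong-≤ 2 n (λ {m} m≤n → T-cong-≤ 4 m λ {l} l≤m → trans (parity-A₂ l) (cong (altSeries∞ 2 l ⊕_) (sym (trunc (≤-trans l≤m m≤n))))) ⟩
  T 2 (T 4 (altSeries∞ 2 ⊞ (λ m → Σ< n (λ i → rankSeries i m)))) n
    ≡⟨ trans (T-cong 2 (T-⊞ 4 (altSeries∞ 2) _) n) (T-⊞ 2 (T 4 (altSeries∞ 2)) _ n) ⟩
  T 2 (T 4 (altSeries∞ 2)) n ⊕ T 2 (T 4 (λ m → Σ< n (λ i → rankSeries i m))) n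
    ≡⟨ cong₂ _⊕_ (trans (T-comm 2 4 (altSeries∞ 2) n) (Tprod-altSeries∞ 2 n))
                 (trans (T-cong 2 (T-Σ< 4 n rankSeries) n) (T-Σ< 2 n (T 4 ∘ rankSeries) n)) ⟩
  shift 2 one n ⊕ Σ< n (λ i → T 2 (T 4 (rankSeries i)) n)
    ≡⟨ cong (shift 2 one n ⊕_) (trans (Σ<-cong n λ i _ → rankSeries-partialFractions i n)
         (trans (Σ<-⊕ n _ _) (cong₂ _⊕_ (Σ<-⊕ n _ _) (Σ<-⊕ n _ _)))) ⟩
  shift 2 one n ⊕ ((Σ< n (λ i → shift 2 (lambert (1 + i)) n) ⊕ Σ< n (λ i → shift 1 (lambert (2 + i)) n)) ⊕
                   (Σ< n (λ i → shift 3 (lambert (2 + i)) n) ⊕ Σ< n (λ i → shift 2 (lambert (3 + i)) n)))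
    ≡⟨ cong (shift 2 one n ⊕_) (cong₂ _⊕_
         (cong₂ _⊕_ (Σ<-shift 2 n (lambert ∘ suc) Λ Λ-stable) (Σ<-shift 1 n (lambert ∘ _+_ 2) (lambert 1 ⊞ Λ) Λ-tail₁))
         (cong₂ _⊕_ (Σ<-shift 3 n (lambert ∘ _+_ 2) (lambert 1 ⊞ Λ) Λ-tail₁) (Σ<-shift 2 n (lambert ∘ _+_ 3) (lambert 2 ⊞ (lambert 1 ⊞ Λ)) Λ-tail₂))) ⟩
  _ ∎
  where
  open ≡-Reasoning
  trunc : ∀ {l} → l ≤ n → Σ< n (λ i → rankSeries i l) ≡ Σ< l (λ i → rankSeries i l)
  trunc {l} l≤n = Σ<-extend l≤n λ i l≤i → shift-at-< (Tprod i (altSeries∞ (3 + i))) (<-≤-trans (s≤s l≤i) (m≤n*m (suc i) 2))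

-- The parity of the number of odd divisors

parity-even : ∀ n → parity n ≡ 0ℙ → ∃ λ h → n ≡ 2 * h
parity-even zero          _  = 0 , refl
parity-even (suc (suc n)) eq with h , refl ← parity-even n eq = suc h , sym (*-suc 2 h)

parity-2* : ∀ h → parity (2 * h) ≡ 0ℙ
parity-2* h = ℙ.*-homo-* 2 h

parity-suc : ∀ n → parity (suc n) ≡ 1ℙ ⊕ parity n
parity-suc = ℙ.+-homo-+ 1

parity-∣ : ∀ n → multiples 2 n ≡ 1ℙ ⊕ parity n
parity-∣ n with parity n in eq
... | 0ℙ = ⟦⟧-yes (2 ∣? n) (let h , n≡ = parity-even n eq in divides h (trans n≡ (*-comm 2 h)))
... | 1ℙ = ⟦⟧-no (2 ∣? n) λ { (divides h refl) → contradiction (trans (sym eq) (trans (cong parity (*-comm h 2)) (parity-2* h))) λ () }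

bit : Parity → ℕ
bit 0ℙ = 0
bit 1ℙ = 1

%2-bit : ∀ n → n % 2 ≡ bit (parity n)
%2-bit zero          = refl
%2-bit (suc zero)    = refl
%2-bit (suc (suc n)) = %2-bit n

parity⇒%2 : ∀ m n → parity m ≡ parity n → m % 2 ≡ n % 2
parity⇒%2 m n eq = trans (%2-bit m) (trans (cong bit eq) (sym (%2-bit n)))

%2⇒parity : ∀ m n → m % 2 ≡ n % 2 → parity m ≡ parity n
%2⇒parity m n eq = bit-injective (trans (sym (%2-bit m)) (trans eq (%2-bit n)))
  where
  bit-injective : ∀ {p q} → bit p ≡ bit q → p ≡ q
  bit-injective {0ℙ} {0ℙ} _ = refl
  bit-injective {1ℙ} {1ℙ} _ = refl

⊗-oddˡ : ∀ {p q} → p ⊗ q ≡ 1ℙ → p ≡ 1ℙ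
⊗-oddˡ {1ℙ} _ = refl

square-injective : ∀ {a b} → a * a ≡ b * b → a ≡ b
square-injective {a} {b} eq with <-cmp a b
... | tri< a<b _ _ = contradiction eq (<⇒≢ (*-mono-< a<b a<b))
... | tri≈ _ a≡b _ = a≡b
... | tri> _ _ b<a = contradiction (sym eq) (<⇒≢ (*-mono-< b<a b<a))

^2≡* : ∀ k → k ^ 2 ≡ k * k
^2≡* k = cong (k *_) (*-identityʳ k)

-- The factorization n = (a + 1)(b + 1) with b + 1 odd.
OddCofactor : ℕ → ℕ → ℕ → Set
OddCofactor n a b = suc a * suc b ≡ n × parity (suc b) ≡ 1ℙ

oddCofactor? : ∀ n a b → Dec (OddCofactor n a b)
oddCofactor? n a b = (suc a * suc b ≟ n) ×-dec (parity (suc b) ℙ.≟ 1ℙ)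

oddCofactors : ℕ → ℕ → Parity
oddCofactors n a = Σ< n λ b → ⟦ oddCofactor? n a b ⟧

-- q^r / (1 - q^2r) is the sum of q^(rc) over odd c. With r = `suc a` and c = 2h + 1, the index of
-- the cofactor is b = 2h.
multiples-oddCofactors : ∀ a n → shift (suc a) (multiples (2 * suc a)) n ≡ oddCofactors n a
multiples-oddCofactors a n with n <? suc a
... | yes n<a = trans (shift-at-< (multiples (2 * suc a)) n<a) (sym (Σ<-zero n λ b _ →
  ⟦⟧-no (oddCofactor? n a b) λ (eq , _) → <⇒≱ n<a (≤-trans (m≤m*n (suc a) (suc b)) (≤-reflexive eq))))
... | no n≮a with m , refl ← m≤n⇒∃[o]m+o≡n (≮⇒≥ n≮a) = trans (shift-at-+ (suc a) _ m)
  (sym (Σ<-indicator (oddCofactor? (suc a + m) a) (2 * suc a ∣? m) (suc a + m) unique to from))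
  where
  unique : ∀ {i j} → OddCofactor (suc a + m) a i → OddCofactor (suc a + m) a j → i ≡ j
  unique {i} {j} (eq , _) (eq′ , _) = suc-injective (*-cancelˡ-≡ (suc i) (suc j) (suc a) (trans eq (sym eq′)))
  to : ∀ {i} → OddCofactor (suc a + m) a i → 2 * suc a ∣ m
  to {i} (eq , odd) with h , refl ← parity-even i (trans (sym (ℙ.suc-homo-⁻¹ i)) (cong _⁻¹ odd)) =
    divides h (trans (sym (+-cancelˡ-≡ (suc a) _ _ (trans (sym (*-suc (suc a) (2 * h))) eq)))
      (solve 2 (λ a h → a :* (con 2 :* h) := h :* (con 2 :* a)) refl (suc a) h))
    where
    open +-*-Solver
  from : 2 * suc a ∣ m → ∃ λ i → i < suc a + m × OddCofactor (suc a + m) a i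
  from (divides h refl) = 2 * h , bound , trans (*-suc (suc a) (2 * h)) (cong (_+_ (suc a)) e) , trans (parity-suc (2 * h)) (cong (1ℙ ⊕_) (parity-2* h))
    where
    open +-*-Solver
    e : suc a * (2 * h) ≡ h * (2 * suc a)
    e = solve 2 (λ a h → a :* (con 2 :* h) := h :* (con 2 :* a)) refl (suc a) h
    bound : 2 * h < suc a + h * (2 * suc a)
    bound = s≤s (≤-trans (≤-trans (m≤n*m (2 * h) (suc a)) (≤-reflexive e)) (m≤n+m _ a))

shift-one : ∀ a n → shift a one n ≡ ⟦ a ≟ n ⟧
shift-one zero    zero    = refl
shift-one zero    (suc n) = refl
shift-one (suc a) zero    = refl
shift-one (suc a) (suc n) = trans (shift-one a n) (⟦⟧-cong (a ≟ n) (suc a ≟ suc n) (cong suc) suc-injective)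

-- `lambert` starts at q^3r and so omits the cofactor 1; adding q^r restores it.
lambert-oddCofactors : ∀ a n → lambert (suc a) n ⊕ ⟦ suc a ≟ n ⟧ ≡ oddCofactors n a
lambert-oddCofactors a n = begin
  lambert (suc a) n ⊕ ⟦ suc a ≟ n ⟧
    ≡⟨ cong₂ _⊕_ (sym (shift-+ (suc a) (2 * suc a) (multiples (2 * suc a)) n)) (sym (shift-one (suc a) n)) ⟩
  shift (suc a) (shift (2 * suc a) (multiples (2 * suc a))) n ⊕ shift (suc a) one n
    ≡⟨ shift-⊞ (suc a) _ one n ⟨
  shift (suc a) (shift (2 * suc a) (multiples (2 * suc a)) ⊞ one) n
    ≡⟨ shift-cong (suc a) (λ m → trans (cong (shift (2 * suc a) (multiples (2 * suc a)) m ⊕_) (sym (T-multiples (2 * suc a) m)))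
                                       (cancel (multiples (2 * suc a) m) (shift (2 * suc a) (multiples (2 * suc a)) m))) n ⟩
  shift (suc a) (multiples (2 * suc a)) n
    ≡⟨ multiples-oddCofactors a n ⟩
  oddCofactors n a ∎
  where
  open ≡-Reasoning
  open ℙ-Solver using (solve; _:+_; _:=_; con)
  cancel : ∀ p q → q ⊕ (p ⊕ q) ≡ p
  cancel = solve 2 (λ p q → q :+ (p :+ q) := p) refl

-- Among all factors only `suc n` itself has cofactor 1, so the restored terms amount to a single 1.
Λ-oddCofactors : ∀ n → Λ (suc n) ⊕ 1ℙ ≡ Σ< (suc n) (oddCofactors (suc n))
Λ-oddCofactors n = begin
  Λ (suc n) ⊕ 1ℙ
    ≡⟨ cong (Λ (suc n) ⊕_) (Σ<-indicator (λ a → suc a ≟ suc n) (yes tt) (suc n)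
         (λ { refl refl → refl }) (λ _ → tt) (λ _ → n , ≤-refl , refl)) ⟨
  Λ (suc n) ⊕ Σ< (suc n) (λ a → ⟦ suc a ≟ suc n ⟧)
    ≡⟨ Σ<-⊕ (suc n) _ _ ⟨
  Σ< (suc n) (λ a → lambert (suc a) (suc n) ⊕ ⟦ suc a ≟ suc n ⟧)
    ≡⟨ Σ<-cong (suc n) (λ a _ → lambert-oddCofactors a (suc n)) ⟩
  Σ< (suc n) (oddCofactors (suc n)) ∎
  where open ≡-Reasoning

Σ<-double : ∀ n f → Σ< (2 * n) f ≡ Σ< n (λ i → f (2 * i) ⊕ f (suc (2 * i)))
Σ<-double zero    f = refl
Σ<-double (suc n) f = begin
  Σ< (2 * suc n) f                        ≡⟨ cong (λ m → Σ< m f) (*-suc 2 n) ⟩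
  Σ< (2 * n) f ⊕ f (2 * n) ⊕ f (suc (2 * n)) ≡⟨ ℙ.+-assoc (Σ< (2 * n) f) _ _ ⟩
  Σ< (2 * n) f ⊕ (f (2 * n) ⊕ f (suc (2 * n))) ≡⟨ cong (_⊕ (f (2 * n) ⊕ f (suc (2 * n)))) (Σ<-double n f) ⟩
  Σ< (suc n) (λ i → f (2 * i) ⊕ f (suc (2 * i))) ∎
  where open ≡-Reasoning

-- Next to an odd cofactor, the factor of `2 * h` must be even, and halving it gives a factorization
-- of `h`. Factors are stored minus one, so even indices are the impossible odd factors.
oddCofactors-double : ∀ h → Σ< (2 * h) (oddCofactors (2 * h)) ≡ Σ< h (oddCofactors h)
oddCofactors-double h = trans (Σ<-double h _) (Σ<-cong h λ i _ → cong₂ _⊕_ (even i) (odd i))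
  where
  even : ∀ i → oddCofactors (2 * h) (2 * i) ≡ 0ℙ
  even i = Σ<-zero (2 * h) λ b _ → ⟦⟧-no (oddCofactor? (2 * h) (2 * i) b) λ (eq , odd) → contradiction
    (begin
      0ℙ                                     ≡⟨ parity-2* h ⟨
      parity (2 * h)                         ≡⟨ cong parity eq ⟨
      parity (suc (2 * i) * suc b)           ≡⟨ ℙ.*-homo-* (suc (2 * i)) (suc b) ⟩
      parity (suc (2 * i)) ⊗ parity (suc b)  ≡⟨ cong₂ _⊗_ (trans (parity-suc (2 * i)) (cong (1ℙ ⊕_) (parity-2* i))) odd ⟩
      1ℙ                                     ∎) λ ()
    where open ≡-Reasoning
  double : ∀ i b → suc (suc (2 * i)) * suc b ≡ 2 * (suc i * suc b)
  double = solve 2 (λ i b → (con 2 :+ con 2 :* i) :* (con 1 :+ b) := con 2 :* ((con 1 :+ i) :* (con 1 :+ b))) refl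
    where open +-*-Solver
  odd : ∀ i → oddCofactors (2 * h) (suc (2 * i)) ≡ oddCofactors h i
  odd i = trans
    (Σ<-cong (2 * h) λ b _ → ⟦⟧-cong (oddCofactor? (2 * h) (suc (2 * i)) b) (oddCofactor? h i b)
      (λ (eq , o) → *-cancelˡ-≡ _ _ 2 (trans (sym (double i b)) eq) , o)
      (λ (eq , o) → trans (double i b) (cong (2 *_) eq) , o))
    (Σ<-extend (m≤n*m h 2) λ b h≤b → ⟦⟧-no (oddCofactor? h i b) λ (eq , _) →
      <⇒≱ (s≤s h≤b) (≤-trans (m≤n*m (suc b) (suc i)) (≤-reflexive eq)))

powTwoTimesOddSquare-double : ∀ h → ⟦ powTwoTimesOddSquare? (2 * h) ⟧ ≡ ⟦ powTwoTimesOddSquare? h ⟧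
powTwoTimesOddSquare-double h = ⟦⟧-cong (powTwoTimesOddSquare? (2 * h)) (powTwoTimesOddSquare? h) to from
  where
  to : PowTwoTimesOddSquare (2 * h) → PowTwoTimesOddSquare h
  to (zero , u , odd , eq) = contradiction
    (begin
      0ℙ                   ≡⟨ parity-2* h ⟨
      parity (2 * h)       ≡⟨ cong parity (trans eq (trans (*-identityˡ (u ^ 2)) (^2≡* u))) ⟩
      parity (u * u)       ≡⟨ ℙ.*-homo-* u u ⟩
      parity u ⊗ parity u  ≡⟨ cong₂ _⊗_ (%2⇒parity u 1 odd) (%2⇒parity u 1 odd) ⟩
      1ℙ                   ∎) λ ()
    where open ≡-Reasoning
  to (suc α , u , odd , eq) = α , u , odd , *-cancelˡ-≡ _ _ 2 (trans eq (*-assoc 2 (2 ^ α) (u ^ 2)))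
  from : PowTwoTimesOddSquare h → PowTwoTimesOddSquare (2 * h)
  from (α , u , odd , eq) = suc α , u , odd , trans (cong (2 *_) eq) (sym (*-assoc 2 (2 ^ α) (u ^ 2)))

powTwoTimesOddSquare⇒square : ∀ {n} → parity n ≡ 1ℙ → PowTwoTimesOddSquare n → PerfectSquare n
powTwoTimesOddSquare⇒square odd (zero  , u , _ , eq) = u , trans eq (*-identityˡ (u ^ 2))
powTwoTimesOddSquare⇒square odd (suc α , u , _ , eq) = contradiction
  (trans (sym odd) (trans (cong parity (trans eq (*-assoc 2 (2 ^ α) (u ^ 2)))) (parity-2* (2 ^ α * u ^ 2)))) λ ()

square⇒powTwoTimesOddSquare : ∀ {n} → parity n ≡ 1ℙ → PerfectSquare n → PowTwoTimesOddSquare n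
square⇒powTwoTimesOddSquare odd (u , refl) =
  0 , u , parity⇒%2 u 1 (⊗-oddˡ (trans (sym (ℙ.*-homo-* u u)) (trans (cong parity (sym (^2≡* u))) odd))) , sym (*-identityˡ (u ^ 2))

-- Interchanging the two factors leaves only the square factorizations.
oddCofactors-odd : ∀ n → parity n ≡ 1ℙ → Σ< n (oddCofactors n) ≡ ⟦ powTwoTimesOddSquare? n ⟧
oddCofactors-odd n odd = trans
  (Σ<-symmetric n λ a b → ⟦⟧-cong (oddCofactor? n a b) (oddCofactor? n b a) (swap {a} {b}) (swap {b} {a}))
  (Σ<-indicator (λ a → oddCofactor? n a a) (powTwoTimesOddSquare? n) n
    (λ {a} {b} (eq , _) (eq′ , _) → suc-injective (square-injective {suc a} {suc b} (trans eq (sym eq′))))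
    (λ {a} (eq , _) → square⇒powTwoTimesOddSquare odd (suc a , trans (sym eq) (sym (^2≡* (suc a)))))
    (from ∘ powTwoTimesOddSquare⇒square odd))
  where
  oddˡ : ∀ {a b} → a * b ≡ n → parity a ≡ 1ℙ
  oddˡ {a} {b} refl = ⊗-oddˡ (trans (sym (ℙ.*-homo-* a b)) odd)
  -- Every factor of an odd number is odd, so the oddness condition survives the interchange.
  swap : ∀ {a b} → OddCofactor n a b → OddCofactor n b a
  swap {a} {b} (eq , _) = trans (*-comm (suc b) (suc a)) eq , oddˡ {suc a} {suc b} eq
  from : PerfectSquare n → ∃ λ a → a < n × OddCofactor n a a
  from (zero  , refl) = contradiction odd λ ()
  from (suc a , eq)   = a , ≤-trans (m≤m*n (suc a) (suc a)) (≤-reflexive eq′) , eq′ , oddˡ {suc a} {suc a} eq′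
    where eq′ = trans (sym (^2≡* (suc a))) (sym eq)

-- Both sides are unchanged by doubling, so strong induction strips the powers of 2 and leaves odd
-- `n`.
oddCofactors-parity : ∀ n → 0 < n → Σ< n (oddCofactors n) ≡ ⟦ powTwoTimesOddSquare? n ⟧
oddCofactors-parity = <-rec _ step
  where
  step : ∀ n → (∀ {m} → m < n → 0 < m → Σ< m (oddCofactors m) ≡ ⟦ powTwoTimesOddSquare? m ⟧) →
         0 < n → Σ< n (oddCofactors n) ≡ ⟦ powTwoTimesOddSquare? n ⟧
  step n ih 0<n with parity n in eq
  ... | 1ℙ = oddCofactors-odd n eq
  ... | 0ℙ with parity-even n eq
  ...   | suc h , refl = trans (oddCofactors-double (suc h))
    (trans (ih (m<m+n (suc h) (s≤s z≤n)) (s≤s z≤n)) (sym (powTwoTimesOddSquare-double (suc h))))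

parity-χ : ∀ n → parity (χ n) ≡ ⟦ powTwoTimesOddSquare? n ⟧
parity-χ n = parity-if (powTwoTimesOddSquare? n)
  where
  parity-if : ∀ {P : Set} (P? : Dec P) → parity (if does P? then 1 else 0) ≡ ⟦ P? ⟧
  parity-if (yes _) = refl
  parity-if (no _)  = refl

parity-χ-Λ : ∀ n → parity (χ (suc n)) ≡ Λ (suc n) ⊕ 1ℙ
parity-χ-Λ n = trans (parity-χ (suc n)) (sym (trans (Λ-oddCofactors n) (oddCofactors-parity (suc n) (s≤s z≤n))))

-- The recurrence and the parity criterion

-- One more `T 2` gives (1 + q²)²(1 + q⁴) = 1 + q⁸ on the left and (q + q³)(1 + q²)Λ = (q + q⁵)Λ on
-- the right, whence the indices 7 and 3.
recurrence : ∀ {A} → T 2 (T 4 A) ≗ lambertSide → ∀ n → A (8 + n) ⊕ A n ≡ Λ (7 + n) ⊕ Λ (3 + n) ⊕ multiples 2 n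
recurrence {A} eq n = begin
  T 8 A (8 + n)
    ≡⟨ trans (T-square 2 (T 4 A) (8 + n)) (T-square 4 A (8 + n)) ⟨
  T 2 (T 2 (T 4 A)) (8 + n)
    ≡⟨ T-cong 2 eq (8 + n) ⟩
  -- At a numeral plus `n` all the shifts evaluate by computation, and the term q² is out of reach.
  ((Λ (6 + n) ⊕ (multiples 2 (4 + n) ⊕ Λ (7 + n))) ⊕
    ((multiples 2 (2 + n) ⊕ Λ (5 + n)) ⊕ (multiples 4 n ⊕ (multiples 2 (3 + n) ⊕ Λ (6 + n))))) ⊕
  ((Λ (4 + n) ⊕ (multiples 2 (2 + n) ⊕ Λ (5 + n))) ⊕
    ((multiples 2 n ⊕ Λ (3 + n)) ⊕ (shift 2 (multiples 4) n ⊕ (multiples 2 (1 + n) ⊕ Λ (4 + n)))))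
    ≡⟨ cong₂ (λ x y → ((Λ (6 + n) ⊕ (x ⊕ Λ (7 + n))) ⊕
                        ((multiples 2 (2 + n) ⊕ Λ (5 + n)) ⊕ (multiples 4 n ⊕ (y ⊕ Λ (6 + n))))) ⊕
                      ((Λ (4 + n) ⊕ (multiples 2 (2 + n) ⊕ Λ (5 + n))) ⊕
                        ((multiples 2 n ⊕ Λ (3 + n)) ⊕ (shift 2 (multiples 4) n ⊕ (multiples 2 (1 + n) ⊕ Λ (4 + n))))))
         (trans (periodic (2 + n)) (periodic n)) (periodic (1 + n)) ⟩
  ((Λ (6 + n) ⊕ (multiples 2 n ⊕ Λ (7 + n))) ⊕
    ((multiples 2 (2 + n) ⊕ Λ (5 + n)) ⊕ (multiples 4 n ⊕ (multiples 2 (1 + n) ⊕ Λ (6 + n))))) ⊕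
  ((Λ (4 + n) ⊕ (multiples 2 (2 + n) ⊕ Λ (5 + n))) ⊕
    ((multiples 2 n ⊕ Λ (3 + n)) ⊕ (shift 2 (multiples 4) n ⊕ (multiples 2 (1 + n) ⊕ Λ (4 + n)))))
    ≡⟨ solve 10 (λ l₃ l₄ l₅ l₆ l₇ a b c x y →
         ((l₆ :+ (a :+ l₇)) :+ ((c :+ l₅) :+ (x :+ (b :+ l₆)))) :+
         ((l₄ :+ (c :+ l₅)) :+ ((a :+ l₃) :+ (y :+ (b :+ l₄)))) := (l₇ :+ l₃) :+ (x :+ y)) refl
         (Λ (3 + n)) (Λ (4 + n)) (Λ (5 + n)) (Λ (6 + n)) (Λ (7 + n))
         (multiples 2 n) (multiples 2 (1 + n)) (multiples 2 (2 + n)) (multiples 4 n) (shift 2 (multiples 4) n) ⟩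
  (Λ (7 + n) ⊕ Λ (3 + n)) ⊕ T 2 (multiples 4) n
    -- (1 + q²) / (1 - q⁴) = 1 / (1 - q²), verified after multiplying both sides by 1 + q².
    ≡⟨ cong (Λ (7 + n) ⊕ Λ (3 + n) ⊕_) (T-injective 2 {T 2 (multiples 4)} {multiples 2} (λ m → trans (T-square 2 (multiples 4) m) (trans (T-multiples 4 m) (sym (T-multiples 2 m)))) n) ⟩
  (Λ (7 + n) ⊕ Λ (3 + n)) ⊕ multiples 2 n ∎
  where
  open ≡-Reasoning
  open ℙ-Solver using (solve; _:+_; _:=_; con)
  periodic : ∀ n → multiples 2 (2 + n) ≡ multiples 2 n
  periodic n = trans (parity-∣ (2 + n)) (sym (parity-∣ n))

-- The two corrections by 1 from the odd divisor counts cancel, and 1 / (1 - q²) contributes the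
-- parity of n + 1.
recurrence-χ : ∀ {A X : ℕ → Parity} → T 2 (T 4 A) ≗ lambertSide → (∀ n → X (suc n) ≡ Λ (suc n) ⊕ 1ℙ) →
               ∀ n → A (n + 8) ⊕ A n ≡ parity (n + 1) ⊕ X (n + 3) ⊕ X (n + 7)
recurrence-χ {A} {X} A-eq X-eq n = begin
  A (n + 8) ⊕ A n
    ≡⟨ cong (λ m → A m ⊕ A n) (+-comm n 8) ⟩
  A (8 + n) ⊕ A n
    ≡⟨ recurrence {A} A-eq n ⟩
  Λ (7 + n) ⊕ Λ (3 + n) ⊕ multiples 2 n
    ≡⟨ solve 3 (λ x y z → x :+ y :+ z := z :+ (y :+ con 1ℙ) :+ (x :+ con 1ℙ)) refl (Λ (7 + n)) (Λ (3 + n)) (multiples 2 n) ⟩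
  multiples 2 n ⊕ (Λ (3 + n) ⊕ 1ℙ) ⊕ (Λ (7 + n) ⊕ 1ℙ)
    ≡⟨ cong₂ _⊕_ (cong₂ _⊕_ (trans (parity-suc n) (sym (parity-∣ n))) (X-eq (2 + n))) (X-eq (6 + n)) ⟨
  parity (1 + n) ⊕ X (3 + n) ⊕ X (7 + n)
    ≡⟨ cong₂ _⊕_ (cong₂ (λ a b → parity a ⊕ X b) (+-comm 1 n) (+-comm 3 n)) (cong X (+-comm 7 n)) ⟩
  parity (n + 1) ⊕ X (n + 3) ⊕ X (n + 7) ∎
  where
  open ≡-Reasoning
  open ℙ-Solver using (solve; _:+_; _:=_; con)

A₂-parity : ∀ n → parity (A₂ (n + 8)) ⊕ parity (A₂ n) ≡ parity (n + 1) ⊕ parity (χ (n + 3)) ⊕ parity (χ (n + 7))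
A₂-parity = recurrence-χ {λ n → parity (A₂ n)} {λ n → parity (χ n)} T2T4-A₂ parity-χ-Λ

parity-χ-square : ∀ n → parity n ≡ 1ℙ → PerfectSquare n ⇔ (parity (χ n) ≡ 1ℙ)
parity-χ-square n odd = mk⇔
  (λ sq → trans (parity-χ n) (⟦⟧-yes (powTwoTimesOddSquare? n) (square⇒powTwoTimesOddSquare odd sq)))
  (λ eq → from (powTwoTimesOddSquare? n) (trans (sym (parity-χ n)) eq))
  where
  from : (P? : Dec (PowTwoTimesOddSquare n)) → ⟦ P? ⟧ ≡ 1ℙ → PerfectSquare n
  from (yes p) _ = powTwoTimesOddSquare⇒square odd p

-- Squares a² and a² + 4 force (a + 1)² ≤ a² + 4, hence a ≤ 1, whereas n + 3 is larger than 1.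
-- Without this, two odd values of χ could cancel in the criterion.
¬square-both : ∀ n → PerfectSquare (n + 3) → ¬ PerfectSquare (n + 7)
¬square-both n (a , eq) (b , eq′) = large a (+-cancelˡ-≤ (a * a) _ _ (begin
    a * a + suc (a + a)  ≡⟨ solve 1 (λ a → a :* a :+ (con 1 :+ (a :+ a)) := (con 1 :+ a) :* (con 1 :+ a)) refl a ⟩
    suc a * suc a        ≤⟨ *-mono-≤ a<b a<b ⟩
    b * b                ≡⟨ b²≡a²+4 ⟩
    a * a + 4            ∎)) (trans (+-comm 3 n) (trans eq (^2≡* a)))
  where
  open ≤-Reasoning
  open +-*-Solver using (solve; _:+_; _:*_; _:=_; con)
  b²≡a²+4 : b * b ≡ a * a + 4
  b²≡a²+4 = trans (sym (^2≡* b)) (trans (sym eq′) (trans (sym (+-assoc n 3 4)) (cong (_+ 4) (trans eq (^2≡* a)))))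
  a<b : a < b
  a<b = ≰⇒> λ b≤a → <⇒≱ (m<m+n (a * a) (s≤s z≤n)) (≤-trans (≤-reflexive (sym b²≡a²+4)) (*-mono-≤ b≤a b≤a))
  large : ∀ a → suc (a + a) ≤ 4 → 3 + n ≡ a * a → ⊥
  large zero          _ ()
  large (suc zero)    _ ()
  large (suc (suc a)) (s≤s (s≤s (s≤s p))) _ = <⇒≱ (s≤s (s≤s z≤n)) (≤-trans (m≤n+m (suc (suc a)) a) p)

-- A and X stand for A₂ and χ, kept variable so that they do not unfold.
parity-criterion :
  ∀ {A X : ℕ → ℕ} →
  (∀ n → parity (A (n + 8)) ⊕ parity (A n) ≡ parity (n + 1) ⊕ parity (X (n + 3)) ⊕ parity (X (n + 7))) →
  (∀ n → parity n ≡ 1ℙ → PerfectSquare n ⇔ (parity (X n) ≡ 1ℙ)) →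
  (∀ n → (A (n + 8) + A n) % 2 ≡ (n + 1 + X (n + 3) + X (n + 7)) % 2) ×
  (∀ n → 2 ∣ n → (A (n + 8) % 2 ≡ A n % 2) ⇔ (PerfectSquare (n + 3) ⊎ PerfectSquare (n + 7)))
parity-criterion {A} {X} A-parity X-square = congruence , λ n 2∣n → mk⇔
  (λ eq → square n 2∣n (%2⇒parity (A (n + 8)) (A n) eq))
  (λ sq → parity⇒%2 (A (n + 8)) (A n) (same n 2∣n sq))
  where
  open ≡-Reasoning
  open Equivalence

  congruence : ∀ n → (A (n + 8) + A n) % 2 ≡ (n + 1 + X (n + 3) + X (n + 7)) % 2
  congruence n = parity⇒%2 (A (n + 8) + A n) (n + 1 + X (n + 3) + X (n + 7)) (begin
    parity (A (n + 8) + A n)                                     ≡⟨ ℙ.+-homo-+ (A (n + 8)) (A n) ⟩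
    parity (A (n + 8)) ⊕ parity (A n)                            ≡⟨ A-parity n ⟩
    parity (n + 1) ⊕ parity (X (n + 3)) ⊕ parity (X (n + 7))       ≡⟨ cong (_⊕ parity (X (n + 7))) (ℙ.+-homo-+ (n + 1) (X (n + 3))) ⟨
    parity (n + 1 + X (n + 3)) ⊕ parity (X (n + 7))                ≡⟨ ℙ.+-homo-+ (n + 1 + X (n + 3)) (X (n + 7)) ⟨
    parity (n + 1 + X (n + 3) + X (n + 7))                         ∎)

  odd : ∀ n k → 2 ∣ n → parity k ≡ 1ℙ → parity (n + k) ≡ 1ℙ
  odd n k (divides h refl) pk = trans (ℙ.+-homo-+ (h * 2) k) (cong₂ _⊕_ (trans (cong parity (*-comm h 2)) (parity-2* h)) pk)

  even-parity : ∀ n → 2 ∣ n → parity (A (n + 8)) ⊕ parity (A n) ≡ 1ℙ ⊕ parity (X (n + 3)) ⊕ parity (X (n + 7))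
  even-parity n 2∣n = trans (A-parity n) (cong (λ p → p ⊕ parity (X (n + 3)) ⊕ parity (X (n + 7))) (odd n 1 2∣n refl))

  square : ∀ n → 2 ∣ n → parity (A (n + 8)) ≡ parity (A n) → PerfectSquare (n + 3) ⊎ PerfectSquare (n + 7)
  -- The equation is matched together with the two parities, so that the case in which both are 0
  -- reads 1 = 0 and drops out.
  square n 2∣n eq with parity (X (n + 3)) in e₃ | parity (X (n + 7)) in e₇
    | trans (sym (even-parity n 2∣n)) (trans (cong (_⊕ parity (A n)) eq) (ℙ.p+p≡0ℙ (parity (A n))))
  ... | 1ℙ | _  | _ = inj₁ (X-square (n + 3) (odd n 3 2∣n refl) .from e₃)
  ... | 0ℙ | 1ℙ | _ = inj₂ (X-square (n + 7) (odd n 7 2∣n refl) .from e₇)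

  same : ∀ n → 2 ∣ n → PerfectSquare (n + 3) ⊎ PerfectSquare (n + 7) → parity (A (n + 8)) ≡ parity (A n)
  same n 2∣n sq = ℙ.+-cancelʳ-≡ (parity (A n)) _ _ (begin
    parity (A (n + 8)) ⊕ parity (A n)                    ≡⟨ even-parity n 2∣n ⟩
    1ℙ ⊕ parity (X (n + 3)) ⊕ parity (X (n + 7))           ≡⟨ one-square sq ⟩
    0ℙ                                                     ≡⟨ ℙ.p+p≡0ℙ (parity (A n)) ⟨
    parity (A n) ⊕ parity (A n)                          ∎)
    where
    ≢1⇒≡0 : ∀ {p} → p ≢ 1ℙ → p ≡ 0ℙ
    ≢1⇒≡0 {0ℙ} _  = refl
    ≢1⇒≡0 {1ℙ} ≢1 = contradiction refl ≢1
    one-square : PerfectSquare (n + 3) ⊎ PerfectSquare (n + 7) → 1ℙ ⊕ parity (X (n + 3)) ⊕ parity (X (n + 7)) ≡ 0ℙ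
    one-square (inj₁ sq₃) = cong₂ (λ p q → 1ℙ ⊕ p ⊕ q) (X-square (n + 3) (odd n 3 2∣n refl) .to sq₃)
      (≢1⇒≡0 λ e₇ → ¬square-both n sq₃ (X-square (n + 7) (odd n 7 2∣n refl) .from e₇))
    one-square (inj₂ sq₇) = cong₂ (λ p q → 1ℙ ⊕ p ⊕ q)
      (≢1⇒≡0 λ e₃ → ¬square-both n (X-square (n + 3) (odd n 3 2∣n refl) .from e₃) sq₇)
      (X-square (n + 7) (odd n 7 2∣n refl) .to sq₇)

theorem7p3 : (∀ (n : ℕ) → (A₂ (n + 8) + A₂ n) % 2 ≡ (n + 1 + χ (n + 3) + χ (n + 7)) % 2)
    × (∀ (n : ℕ) → 2 ∣ n → (A₂ (n + 8) % 2 ≡ A₂ n % 2) ⇔ (PerfectSquare (n + 3) ⊎ PerfectSquare (n + 7)))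
theorem7p3 = parity-criterion {A₂} {χ} A₂-parity parity-χ-square
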